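{- Let $L$ be a valid lattice and $\varphi\in\mathscr{F}(L)\cap\operatorname{int}(Q)$, where $Q=\{(x,y)\in\mathbb{R}^2:|x|+|y|\le\frac12\}$. Then any two distinct tilings of $\mathbb{T}_L$ with flux $\varphi$ can be joined by a (finite) sequence of flips.
   Context: The unit square $[i,i+1]\times[j,j+1]$ ($i,j\in\mathbb{Z}$) is black if $i+j$ is even and white otherwise. A domino is the union of two unit squares sharing a side; a tiling of $\mathbb{Z}^2$ is a set of dominoes with pairwise disjoint interiors covering $\mathbb{R}^2$. Let $\mathscr{E}=2\mathbb{Z}^2$, $\mathscr{O}=2\mathbb{Z}^2+(1,1)$. A valid lattice is a subgroup $L\subset\mathbb{Z}^2$ generated by two linearly independent vectors in $\mathscr{E}\sqcup\mathscr{O}$. A tiling of $\mathbb{T}_L=\mathbb{R}^2/L$ is identified with an $L$-periodic tiling of $\mathbb{Z}^2$. Flips on the torus: if two parallel dominoes of an $L$-periodic tiling $t$ form a $2\times2$ square with center $v\in\mathbb{Z}^2$, then the same holds around each point of $v+L$, and a flip of $t$ (as a tiling of $\mathbb{T}_L$), also called an $L$-flip round $v$, replaces, simultaneously around every point of $v+L$, these two dominoes by the other two-domino tiling of the $2\times 2$ square. The result is again a tiling of $\mathbb{T}_L$. Height functions: each unit edge between neighboring points of $\mathbb{Z}^2$ is oriented so that the boundary of every black square is oriented clockwise. The height function $h_t:\mathbb{Z}^2\to\mathbb{Z}$ of a tiling $t$ satisfies $h_t(0)=0$ and, for every edge oriented from $u$ to $w$: $h_t(w)=h_t(u)+1$ if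 the edge is not the common side of the two squares of a domino of $t$, and $h_t(w)=h_t(u)-3$ otherwise. Flux: for a tiling $t$ of $\mathbb{T}_L$, $h_t(u+v)-h_t(u)$ depends only on $v\in L$ and is additive in $v$; the flux of $t$ is the unique $\varphi_t\in\mathbb{R}^2$ with $4\langle\varphi_t,v\rangle=h_t(u+v)-h_t(u)$ for all $v\in L$, $u\in\mathbb{Z}^2$. $\mathscr{F}(L)$ is the set of fluxes of all tilings of $\mathbb{T}_L$. -}

module Defs where

open import Data.Integer.Base as ℤ using (ℤ; +_; 0ℤ; 1ℤ; -1ℤ)
open import Data.Integer.Divisibility using (_∣_)
open import Data.Product.Base using (_×_; _,_; ∃-syntax)
open import Data.Rational.Base as ℚ using (ℚ; 0ℚ; ½)
open import Data.Sum.Base using (_⊎_)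
open import Level using (0ℓ) renaming (suc to lsuc)
open import Relation.Binary.Core using (Rel)
open import Relation.Binary.PropositionalEquality using (_≡_)
open import Relation.Unary using (Pred; _∈_; _∉_; _⊆_; _≐_; _∪_; _∖_; _⊢_)

ℤ² : Set
ℤ² = ℤ × ℤ

ℚ² : Set
ℚ² = ℚ × ℚ

infixl 6 _⊕_
infixl 7 _·_

_⊕_ : ℤ² → ℤ² → ℤ²
(a , b) ⊕ (c , d) = (a ℤ.+ c , b ℤ.+ d)

_·_ : ℤ → ℤ² → ℤ²
m · (a , b) = (m ℤ.* a , m ℤ.* b)

𝟎 e₁ e₂ : ℤ²
𝟎  = (0ℤ , 0ℤ)
e₁ = (1ℤ , 0ℤ)
e₂ = (0ℤ , 1ℤ)

-e₁ -e₂ : ℤ²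
-e₁ = (-1ℤ , 0ℤ)
-e₂ = (0ℤ , -1ℤ)

𝓔 : Pred ℤ² 0ℓ
𝓔 p = ∃[ q ] p ≡ (+ 2) · q

𝓞 : Pred ℤ² 0ℓ
𝓞 p = ∃[ q ] p ≡ (+ 2) · q ⊕ (1ℤ , 1ℤ)

-- For integer vectors, independence over ℤ and over ℝ coincide.
LinearlyIndependent : ℤ² → ℤ² → Set
LinearlyIndependent b c = ∀ m n → m · b ⊕ n · c ≡ 𝟎 → m ≡ 0ℤ × n ≡ 0ℤ

⟨_,_⟩ : ℤ² → ℤ² → Pred ℤ² 0ℓ
⟨ b , c ⟩ p = ∃[ m ] ∃[ n ] p ≡ m · b ⊕ n · c

record ValidLattice (L : Pred ℤ² 0ℓ) : Set where
  field
    b₁ b₂       : ℤ²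
    b₁∈𝓔⊔𝓞      : b₁ ∈ 𝓔 ∪ 𝓞
    b₂∈𝓔⊔𝓞      : b₂ ∈ 𝓔 ∪ 𝓞
    independent : LinearlyIndependent b₁ b₂
    generated   : L ≐ ⟨ b₁ , b₂ ⟩

-- The point (i , j) also names the unit square [i,i+1] × [j,j+1].
Black : Pred ℤ² 0ℓ
Black (i , j) = + 2 ∣ i ℤ.+ j

-- A domino is named by its lower-left square: `horizontal s` is the union of
-- s and s ⊕ e₁, and `vertical s` the union of s and s ⊕ e₂.
data Domino : Set where
  horizontal vertical : ℤ² → Domino

squaresOf : Domino → Pred ℤ² 0ℓ
squaresOf (horizontal s) p = p ≡ s ⊎ p ≡ s ⊕ e₁
squaresOf (vertical   s) p = p ≡ s ⊎ p ≡ s ⊕ e₂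

translate : ℤ² → Domino → Domino
translate v (horizontal s) = horizontal (s ⊕ v)
translate v (vertical   s) = vertical   (s ⊕ v)

-- Dominoes are unions of unit squares, so they cover ℝ² iff they cover every
-- square, and two of them have disjoint interiors iff they share no square.
record IsTiling (t : Pred Domino 0ℓ) : Set where
  field
    covering : ∀ s → ∃[ d ] d ∈ t × s ∈ squaresOf d
    disjoint : ∀ {d d′ s} → d ∈ t → d′ ∈ t →
               s ∈ squaresOf d → s ∈ squaresOf d′ → d ≡ d′

Periodic : Pred ℤ² 0ℓ → Pred Domino 0ℓ → Set
Periodic L t = ∀ {v} → v ∈ L → t ≐ (translate v ⊢ t)

record TorusTiling (L : Pred ℤ² 0ℓ) : Set (lsuc 0ℓ) where
  field
    dominoes : Pred Domino 0ℓ
    isTiling : IsTiling dominoes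
    periodic : Periodic L dominoes

open TorusTiling public

infix 4 _≈_

_≈_ : ∀ {L} → Rel (TorusTiling L) 0ℓ
t ≈ t′ = dominoes t ≐ dominoes t′

data Orientation : Set where
  hor ver : Orientation

opposite : Orientation → Orientation
opposite hor = ver
opposite ver = hor

-- The two parallel dominoes tiling the 2 × 2 square with centre v.
pair : Orientation → ℤ² → Pred Domino 0ℓ
pair hor v d = d ≡ horizontal (v ⊕ -e₁ ⊕ -e₂) ⊎ d ≡ horizontal (v ⊕ -e₁)
pair ver v d = d ≡ vertical   (v ⊕ -e₁ ⊕ -e₂) ⊎ d ≡ vertical   (v ⊕ -e₂)

pairs : Pred ℤ² 0ℓ → Orientation → ℤ² → Pred Domino 0ℓ
pairs L o v d = ∃[ w ] w ∈ L × d ∈ pair o (v ⊕ w)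

Flip : (L : Pred ℤ² 0ℓ) → Rel (TorusTiling L) 0ℓ
Flip L t t′ = ∃[ v ] ∃[ o ]
    pair o v ⊆ dominoes t
  × dominoes t′ ≐ (dominoes t ∖ pairs L o v) ∪ pairs L (opposite o) v

data Side : Set where
  left top right bottom : Side

-- `source s k` and `target s k` are the endpoints of side k of the square s,
-- in the order in which the boundary of s is traversed clockwise.
source target : ℤ² → Side → ℤ²
source s left   = s
source s top    = s ⊕ e₂
source s right  = s ⊕ e₁ ⊕ e₂
source s bottom = s ⊕ e₁
target s left   = s ⊕ e₂
target s top    = s ⊕ e₁ ⊕ e₂
target s right  = s ⊕ e₁
target s bottom = s

-- The domino made of s and its neighbour across side k.
across : ℤ² → Side → Domino
across s left   = horizontal (s ⊕ -e₁)
across s top    = vertical s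
across s right  = horizontal s
across s bottom = vertical (s ⊕ -e₂)

-- Every unit edge is a side of exactly one black square, so quantifying over
-- the sides of black squares visits every oriented edge once.
record IsHeightFunction (t : Pred Domino 0ℓ) (h : ℤ² → ℤ) : Set where
  field
    origin   : h 𝟎 ≡ 0ℤ
    step     : ∀ s k → Black s → across s k ∉ t →
               h (target s k) ≡ h (source s k) ℤ.+ + 1
    stepOver : ∀ s k → Black s → across s k ∈ t →
               h (target s k) ≡ h (source s k) ℤ.- + 3

fromℤ : ℤ → ℚ
fromℤ n = n ℚ./ 1

⟪_,_⟫ : ℚ² → ℤ² → ℚ
⟪ (x , y) , (a , b) ⟫ = x ℚ.* fromℤ a ℚ.+ y ℚ.* fromℤ b

-- The flux solves a nonsingular linear system with integer coefficients, so it
-- is rational and nothing is lost by working in ℚ² instead of ℝ².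
HasFlux : ∀ {L} → TorusTiling L → Pred ℚ² 0ℓ
HasFlux {L} t φ = ∃[ h ] IsHeightFunction (dominoes t) h ×
  (∀ v u → v ∈ L → fromℤ (+ 4) ℚ.* ⟪ φ , v ⟫ ≡ fromℤ (h (u ⊕ v) ℤ.- h u))

𝓕 : Pred ℤ² 0ℓ → Pred ℚ² (lsuc 0ℓ)
𝓕 L φ = ∃[ t ] HasFlux {L} t φ

Q : Pred ℚ² 0ℓ
Q (x , y) = ℚ.∣ x ∣ ℚ.+ ℚ.∣ y ∣ ℚ.≤ ½

-- Topological interior, for the topology of the supremum norm.  For the
-- polygon Q, the interior in ℚ² is the trace on ℚ² of the interior in ℝ².
int : Pred ℚ² 0ℓ → Pred ℚ² 0ℓ
int S (x , y) = ∃[ ε ] 0ℚ ℚ.< ε ×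
  (∀ x′ y′ → ℚ.∣ x′ ℚ.- x ∣ ℚ.< ε → ℚ.∣ y′ ℚ.- y ∣ ℚ.< ε → (x′ , y′) ∈ S)

{-# OPTIONS --safe #-}

-- Let h and h′ be height functions of t and t′, with h shifted by a multiple
-- of 4 so that h ≥ h′; their difference is 4D with D periodic.  If D is
-- positive somewhere, start there and follow edges along which h rises.  Such
-- an edge raises h by 1, so D does not decrease.  Edges out of consecutive
-- vertices are alternately vertical and horizontal, so 2k steps move by
-- (a , b) with |a|, |b| ≤ k and raise h by 2k.  If this never stopped, two
-- vertices would agree modulo L by the pigeonhole principle, giving
-- 4⟨φ , (a , b)⟩ = 2k, which contradicts |x| + |y| < ½ for φ = (x , y).
-- So the walk ends at a vertex v with D v > 0 from which no edge rises: both
-- edges out of v are crossed by dominoes, and the flip round v lowers h by 4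
-- on v + L.  Repeating this brings h down to h′.
module Submission where

open import Defs
open import Data.Bool.Base using (Bool; true; false)
open import Data.Fin.Base as Fin using (Fin; toℕ)
import Data.Fin.Properties as Fin
open import Data.Integer.Base as ℤ using (ℤ; +_; -[1+_]; 0ℤ; 1ℤ; -1ℤ; ∣_∣; _⊖_)
open import Data.Integer.Divisibility.Signed as ℤ using (_∣_; divides)
import Data.Integer.DivMod as ℤ
import Data.Integer.Properties as ℤ
open import Data.Integer.Tactic.RingSolver using (solve-∀)
open import Data.List.Base using (List; []; _∷_; cartesianProductWith; length; lookup; map; upTo)
open import Data.List.Membership.Propositional using (find; lose) renaming (_∈_ to _∈ˡ_)
open import Data.List.Membership.Propositional.Properties using (∈-cartesianProductWith⁺; ∈-upTo⁺)
open import Data.List.Relation.Unary.Any as Any using (here; there; any?)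
open import Data.List.Relation.Unary.Any.Properties using (lookup-index)
open import Data.Nat.Base as ℕ using (ℕ; zero; suc; pred; z≤n; s≤s; z<s; s<s; parity)
import Data.Nat.Coprimality as Coprime
import Data.Nat.Divisibility as ℕ
open import Data.Nat.ListAction using (sum)
import Data.Nat.Properties as ℕ
open import Data.Parity.Base as ℙ using (Parity; 0ℙ; 1ℙ; _⁻¹)
import Data.Parity.Properties as ℙ
open import Data.Product.Base using (_×_; _,_; proj₁; proj₂; ∃-syntax; Σ-syntax; map₂)
import Data.Product.Properties as Product
open import Data.Rational.Base as ℚ using (ℚ; 0ℚ; ½)
import Data.Rational.Properties as ℚ
open import Data.Sum.Base using (_⊎_; inj₁; inj₂; [_,_]′)
open import Function.Base using (_∘_; _$_; case_of_; id)
open import Level using (0ℓ)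
open import Relation.Binary.Construct.Closure.ReflexiveTransitive using (Star; ε; _◅_)
open import Relation.Binary.Definitions using (DecidableEquality)
open import Relation.Binary.PropositionalEquality
open import Relation.Nullary.Decidable using (Dec; yes; no; map′; _×-dec_)
open import Relation.Nullary.Negation using (¬_; contradiction)
open import Relation.Unary using (Pred; _∈_; _∉_; _≐_; _∩_; _∪_; _∖_)

import Algebra.Properties.AbelianGroup ℤ.+-0-abelianGroup as ℤ+
import Algebra.Properties.AbelianGroup ℚ.+-0-abelianGroup as ℚ+

-- The integer plane

-- Flips are carried out on functions rather than on sets of dominoes. A function whose increments
-- along the oriented edges are all +1 or -3 has exactly one -3 around each unit square, so the
-- edges with increment -3 are those crossed by the dominoes of a tiling. Since -3 and +1 differ by
-- 4, two such functions that agree at one point agree modulo 4 everywhere, and lowering a peak by 4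
-- exchanges the two increments at its edges. Equal flux makes both functions gain the same along L;
-- hence D is periodic.
--
-- The lower function h′ of the overview stays fixed. In the part on descent it is called `h`, and
-- `lift h D` is the current upper function. The descent ends because the sum of D over a finite
-- list of representatives modulo L drops with each flip.
--
-- Vectors of L have even coordinate sum, so translation by L preserves the orientation of edges,
-- and v + L contains no two adjacent vertices: the simultaneous flips do not interfere, however
-- small the torus.

⊖_ : ℤ² → ℤ²
⊖ (a , b) = (ℤ.- a , ℤ.- b)

⊕-assoc : ∀ p q r → p ⊕ q ⊕ r ≡ p ⊕ (q ⊕ r)
⊕-assoc (a , b) (c , d) (e , f) = cong₂ _,_ (ℤ.+-assoc a c e) (ℤ.+-assoc b d f)

⊕-comm : ∀ p q → p ⊕ q ≡ q ⊕ p
⊕-comm (a , b) (c , d) = cong₂ _,_ (ℤ.+-comm a c) (ℤ.+-comm b d)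

⊕-identityʳ : ∀ p → p ⊕ 𝟎 ≡ p
⊕-identityʳ (a , b) = cong₂ _,_ (ℤ.+-identityʳ a) (ℤ.+-identityʳ b)

⊕-inverseʳ : ∀ p → p ⊕ ⊖ p ≡ 𝟎
⊕-inverseʳ (a , b) = cong₂ _,_ (ℤ.+-inverseʳ a) (ℤ.+-inverseʳ b)

⊕-swap : ∀ p q r → p ⊕ q ⊕ r ≡ p ⊕ r ⊕ q
⊕-swap p q r = trans (⊕-assoc p q r) (trans (cong (p ⊕_) (⊕-comm q r)) (sym (⊕-assoc p r q)))

p⊕q⊕⊖q≡p : ∀ p q → p ⊕ q ⊕ ⊖ q ≡ p
p⊕q⊕⊖q≡p p q = trans (⊕-assoc p q (⊖ q)) (trans (cong (p ⊕_) (⊕-inverseʳ q)) (⊕-identityʳ p))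

p⊕⊖q⊕q≡p : ∀ p q → p ⊕ ⊖ q ⊕ q ≡ p
p⊕⊖q⊕q≡p p q = trans (⊕-swap p (⊖ q) q) (p⊕q⊕⊖q≡p p q)

⊕-cancelˡ : ∀ p {q r} → p ⊕ q ≡ p ⊕ r → q ≡ r
⊕-cancelˡ p {q} {r} eq = begin
  q           ≡⟨ p⊕q⊕⊖q≡p q p ⟨
  q ⊕ p ⊕ ⊖ p ≡⟨ cong (_⊕ ⊖ p) (trans (⊕-comm q p) (trans eq (⊕-comm p r))) ⟩
  r ⊕ p ⊕ ⊖ p ≡⟨ p⊕q⊕⊖q≡p r p ⟩
  r           ∎
  where open ≡-Reasoning

⊕-assoc₃ : ∀ p q r s → p ⊕ q ⊕ r ⊕ s ≡ p ⊕ (q ⊕ r ⊕ s)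
⊕-assoc₃ p q r s = trans (⊕-assoc (p ⊕ q) r s) (trans (⊕-assoc p q (r ⊕ s)) (cong (p ⊕_) (sym (⊕-assoc q r s))))

-- For closed q, r and s the hypotheses of the next two lemmas hold by refl.
⊕-cancel₂ : ∀ p q r → q ⊕ r ≡ 𝟎 → p ⊕ q ⊕ r ≡ p
⊕-cancel₂ p q r eq = trans (⊕-assoc p q r) (trans (cong (p ⊕_) eq) (⊕-identityʳ p))

⊕-cancel₃ : ∀ p q r s → q ⊕ r ⊕ s ≡ 𝟎 → p ⊕ q ⊕ r ⊕ s ≡ p
⊕-cancel₃ p q r s eq = trans (⊕-assoc₃ p q r s) (trans (cong (p ⊕_) eq) (⊕-identityʳ p))

-- Parity and the checkerboard colouring

parity-⊖ : ∀ m n → parity ∣ m ⊖ n ∣ ≡ parity m ℙ.+ parity n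
parity-⊖ m       zero    = sym (ℙ.+-identityʳ (parity m))
parity-⊖ zero    (suc n) = refl
parity-⊖ (suc m) (suc n) = trans
  (cong (parity ∘ ∣_∣) (ℤ.[1+m]⊖[1+n]≡m⊖n m n))
  (trans (parity-⊖ m n) (lemma (ℙ.suc-homo-⁻¹ m) (ℙ.suc-homo-⁻¹ n)))
  where
  lemma : ∀ {p q p′ q′} → p ⁻¹ ≡ p′ → q ⁻¹ ≡ q′ → p′ ℙ.+ q′ ≡ p ℙ.+ q
  lemma {0ℙ} {0ℙ} refl refl = refl
  lemma {0ℙ} {1ℙ} refl refl = refl
  lemma {1ℙ} {0ℙ} refl refl = refl
  lemma {1ℙ} {1ℙ} refl refl = refl

parity-+ : ∀ i j → parity ∣ i ℤ.+ j ∣ ≡ parity ∣ i ∣ ℙ.+ parity ∣ j ∣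
parity-+ (+ m)    (+ n)    = ℙ.+-homo-+ m n
parity-+ (+ m)    -[1+ n ] = parity-⊖ m (suc n)
parity-+ -[1+ m ] (+ n)    = trans (parity-⊖ n (suc m)) (ℙ.+-comm (parity n) _)
parity-+ -[1+ m ] -[1+ n ] = trans (cong parity (cong suc (sym (ℕ.+-suc m n)))) (ℙ.+-homo-+ (suc m) (suc n))

colour : ℤ² → Parity
colour (i , j) = parity ∣ i ℤ.+ j ∣

-- The summand `c` stands first on the right because `ℙ._+_` computes on its first argument: the sum
-- reduces for closed `c`, and once `colour c` is replaced by `0ℙ`.
colour-⊕ : ∀ p c → colour (p ⊕ c) ≡ colour c ℙ.+ colour p
colour-⊕ (a , b) (c , d) = begin
  parity ∣ (a ℤ.+ c) ℤ.+ (b ℤ.+ d) ∣ ≡⟨ cong (parity ∘ ∣_∣) (lemma a b c d) ⟩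
  parity ∣ (c ℤ.+ d) ℤ.+ (a ℤ.+ b) ∣ ≡⟨ parity-+ (c ℤ.+ d) (a ℤ.+ b) ⟩
  colour (c , d) ℙ.+ colour (a , b)  ∎
  where
  open ≡-Reasoning
  lemma : ∀ a b c d → (a ℤ.+ c) ℤ.+ (b ℤ.+ d) ≡ (c ℤ.+ d) ℤ.+ (a ℤ.+ b)
  lemma = solve-∀

parity≡0ℙ⇒2∣ : ∀ n → parity n ≡ 0ℙ → 2 ℕ.∣ n
parity≡0ℙ⇒2∣ zero          _  = ℕ.divides 0 refl
parity≡0ℙ⇒2∣ (suc (suc n)) eq with ℕ.divides q refl ← parity≡0ℙ⇒2∣ n eq = ℕ.divides (suc q) refl

2∣⇒parity≡0ℙ : ∀ {n} → 2 ℕ.∣ n → parity n ≡ 0ℙ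
2∣⇒parity≡0ℙ (ℕ.divides q refl) = trans (ℙ.*-homo-* q 2) (ℙ.*-zeroʳ (parity q))

colour⇒black : ∀ {p} → colour p ≡ 0ℙ → Black p
colour⇒black = parity≡0ℙ⇒2∣ _

colour-⊕′ : ∀ p c {π} → colour p ≡ π → colour (p ⊕ c) ≡ colour c ℙ.+ π
colour-⊕′ p c refl = colour-⊕ p c

-- Dominoes and the edges they straddle

e₁₂ : ℤ²
e₁₂ = (1ℤ , 1ℤ)

-- Dominoes correspond to the unit edges they straddle; src and tgt are the
-- ends of that edge, in the direction of its orientation.
end : Orientation → Parity → ℤ²
end hor 0ℙ = e₁₂
end hor 1ℙ = e₁
end ver 0ℙ = e₂
end ver 1ℙ = e₁₂

src tgt : Domino → ℤ²
src (horizontal p) = p ⊕ end hor (colour p)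
src (vertical   p) = p ⊕ end ver (colour p)
tgt (horizontal p) = p ⊕ end hor (colour p ⁻¹)
tgt (vertical   p) = p ⊕ end ver (colour p ⁻¹)

horizontal-src : ∀ p {π} → colour p ≡ π → src (horizontal p) ≡ p ⊕ end hor π
horizontal-src p refl = refl

horizontal-tgt : ∀ p {π} → colour p ≡ π → tgt (horizontal p) ≡ p ⊕ end hor (π ⁻¹)
horizontal-tgt p refl = refl

vertical-src : ∀ p {π} → colour p ≡ π → src (vertical p) ≡ p ⊕ end ver π
vertical-src p refl = refl

vertical-tgt : ∀ p {π} → colour p ≡ π → tgt (vertical p) ≡ p ⊕ end ver (π ⁻¹)
vertical-tgt p refl = refl

colour-tgt : ∀ d → colour (tgt d) ≡ colour (src d) ⁻¹
colour-tgt (horizontal p) = lemma (colour p) refl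
  where
  lemma : ∀ π → colour p ≡ π → colour (p ⊕ end hor (π ⁻¹)) ≡ colour (p ⊕ end hor π) ⁻¹
  lemma 0ℙ eq = trans (colour-⊕′ p e₁ eq) (sym (cong _⁻¹ (colour-⊕′ p e₁₂ eq)))
  lemma 1ℙ eq = trans (colour-⊕′ p e₁₂ eq) (sym (cong _⁻¹ (colour-⊕′ p e₁ eq)))
colour-tgt (vertical p) = lemma (colour p) refl
  where
  lemma : ∀ π → colour p ≡ π → colour (p ⊕ end ver (π ⁻¹)) ≡ colour (p ⊕ end ver π) ⁻¹
  lemma 0ℙ eq = trans (colour-⊕′ p e₁₂ eq) (sym (cong _⁻¹ (colour-⊕′ p e₂ eq)))
  lemma 1ℙ eq = trans (colour-⊕′ p e₂ eq) (sym (cong _⁻¹ (colour-⊕′ p e₁₂ eq)))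

-- At a vertex of colour `0ℙ` the outgoing edges are vertical, hence straddled by horizontal
-- dominoes; at the other vertices it is the reverse.
around : Parity → Orientation
around 0ℙ = hor
around 1ℙ = ver

-- The two edges out of u are opposite, and so are the two edges into u; the
-- dominoes straddling either two edges tile the 2 × 2 square with centre u.
outgoing incoming : ℤ² → Pred Domino 0ℓ
outgoing u = pair (around (colour u)) u
incoming u = pair (opposite (around (colour u))) u

-- `outgoing` and `incoming` are stuck until the colour of `u` is known, so case distinctions are
-- made on a parity `π` that comes with an equation.
pair-≡ : ∀ (o : Parity → Orientation) u {π d} → colour u ≡ π → pair (o π) u d → pair (o (colour u)) u d
pair-≡ o u refl x = x

src-outgoing : ∀ d → outgoing (src d) d
src-outgoing (horizontal p) = lemma (colour p) refl
  where
  lemma : ∀ π → colour p ≡ π → outgoing (p ⊕ end hor π) (horizontal p)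
  lemma 0ℙ eq = pair-≡ around (p ⊕ e₁₂) (colour-⊕′ p e₁₂ eq)
    (inj₁ (cong horizontal (sym (⊕-cancel₃ p e₁₂ -e₁ -e₂ refl))))
  lemma 1ℙ eq = pair-≡ around (p ⊕ e₁) (colour-⊕′ p e₁ eq)
    (inj₂ (cong horizontal (sym (⊕-cancel₂ p e₁ -e₁ refl))))
src-outgoing (vertical p) = lemma (colour p) refl
  where
  lemma : ∀ π → colour p ≡ π → outgoing (p ⊕ end ver π) (vertical p)
  lemma 0ℙ eq = pair-≡ around (p ⊕ e₂) (colour-⊕′ p e₂ eq)
    (inj₂ (cong vertical (sym (⊕-cancel₂ p e₂ -e₂ refl))))
  lemma 1ℙ eq = pair-≡ around (p ⊕ e₁₂) (colour-⊕′ p e₁₂ eq)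
    (inj₁ (cong vertical (sym (⊕-cancel₃ p e₁₂ -e₁ -e₂ refl))))

tgt-incoming : ∀ d → incoming (tgt d) d
tgt-incoming (horizontal p) = lemma (colour p) refl
  where
  lemma : ∀ π → colour p ≡ π → incoming (p ⊕ end hor (π ⁻¹)) (horizontal p)
  lemma 0ℙ eq = pair-≡ (opposite ∘ around) (p ⊕ e₁) (colour-⊕′ p e₁ eq)
    (inj₂ (cong horizontal (sym (⊕-cancel₂ p e₁ -e₁ refl))))
  lemma 1ℙ eq = pair-≡ (opposite ∘ around) (p ⊕ e₁₂) (colour-⊕′ p e₁₂ eq)
    (inj₁ (cong horizontal (sym (⊕-cancel₃ p e₁₂ -e₁ -e₂ refl))))
tgt-incoming (vertical p) = lemma (colour p) refl
  where
  lemma : ∀ π → colour p ≡ π → incoming (p ⊕ end ver (π ⁻¹)) (vertical p)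
  lemma 0ℙ eq = pair-≡ (opposite ∘ around) (p ⊕ e₁₂) (colour-⊕′ p e₁₂ eq)
    (inj₁ (cong vertical (sym (⊕-cancel₃ p e₁₂ -e₁ -e₂ refl))))
  lemma 1ℙ eq = pair-≡ (opposite ∘ around) (p ⊕ e₂) (colour-⊕′ p e₂ eq)
    (inj₂ (cong vertical (sym (⊕-cancel₂ p e₂ -e₂ refl))))

outgoing⇒src : ∀ u {d} → outgoing u d → src d ≡ u
outgoing⇒src u {d} = lemma (colour u) refl
  where
  lemma : ∀ π → colour u ≡ π → pair (around π) u d → src d ≡ u
  lemma 0ℙ eq (inj₁ refl) = trans
    (horizontal-src (u ⊕ -e₁ ⊕ -e₂) (colour-⊕′ (u ⊕ -e₁) -e₂ (colour-⊕′ u -e₁ eq))) (⊕-cancel₃ u -e₁ -e₂ e₁₂ refl)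
  lemma 0ℙ eq (inj₂ refl) = trans (horizontal-src (u ⊕ -e₁) (colour-⊕′ u -e₁ eq)) (⊕-cancel₂ u -e₁ e₁ refl)
  lemma 1ℙ eq (inj₁ refl) = trans
    (vertical-src (u ⊕ -e₁ ⊕ -e₂) (colour-⊕′ (u ⊕ -e₁) -e₂ (colour-⊕′ u -e₁ eq))) (⊕-cancel₃ u -e₁ -e₂ e₁₂ refl)
  lemma 1ℙ eq (inj₂ refl) = trans (vertical-src (u ⊕ -e₂) (colour-⊕′ u -e₂ eq)) (⊕-cancel₂ u -e₂ e₂ refl)

incoming⇒tgt : ∀ u {d} → incoming u d → tgt d ≡ u
incoming⇒tgt u {d} = lemma (colour u) refl
  where
  lemma : ∀ π → colour u ≡ π → pair (opposite (around π)) u d → tgt d ≡ u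
  lemma 1ℙ eq (inj₁ refl) = trans
    (horizontal-tgt (u ⊕ -e₁ ⊕ -e₂) (colour-⊕′ (u ⊕ -e₁) -e₂ (colour-⊕′ u -e₁ eq))) (⊕-cancel₃ u -e₁ -e₂ e₁₂ refl)
  lemma 1ℙ eq (inj₂ refl) = trans (horizontal-tgt (u ⊕ -e₁) (colour-⊕′ u -e₁ eq)) (⊕-cancel₂ u -e₁ e₁ refl)
  lemma 0ℙ eq (inj₁ refl) = trans
    (vertical-tgt (u ⊕ -e₁ ⊕ -e₂) (colour-⊕′ (u ⊕ -e₁) -e₂ (colour-⊕′ u -e₁ eq))) (⊕-cancel₃ u -e₁ -e₂ e₁₂ refl)
  lemma 0ℙ eq (inj₂ refl) = trans (vertical-tgt (u ⊕ -e₂) (colour-⊕′ u -e₂ eq)) (⊕-cancel₂ u -e₂ e₂ refl)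

-- Both dominoes lie in the 2 × 2 square round the common vertex, one in each of its two tilings,
-- and a horizontal and a vertical domino in a 2 × 2 square always overlap.
shared-square : ∀ d d′ → tgt d ≡ src d′ → ∃[ s ] s ∈ squaresOf d × s ∈ squaresOf d′
shared-square d d′ eq = lemma (tgt d) (colour (tgt d)) (tgt-incoming d)
                        (subst (λ u → outgoing u d′) (sym eq) (src-outgoing d′))
  where
  lemma : ∀ u π {d d′} → pair (opposite (around π)) u d → pair (around π) u d′ →
          ∃[ s ] s ∈ squaresOf d × s ∈ squaresOf d′
  lemma u 0ℙ (inj₁ refl) (inj₁ refl) = u ⊕ -e₁ ⊕ -e₂ , inj₁ refl , inj₁ refl
  lemma u 0ℙ (inj₁ refl) (inj₂ refl) =
    u ⊕ -e₁ , inj₂ (sym (⊕-cancel₂ (u ⊕ -e₁) -e₂ e₂ refl)) , inj₁ refl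
  lemma u 0ℙ (inj₂ refl) (inj₁ refl) =
    u ⊕ -e₂ , inj₁ refl , inj₂ (trans (sym (⊕-cancel₂ (u ⊕ -e₂) -e₁ e₁ refl)) (cong (_⊕ e₁) (⊕-swap u -e₂ -e₁)))
  lemma u 0ℙ (inj₂ refl) (inj₂ refl) =
    u , inj₂ (sym (⊕-cancel₂ u -e₂ e₂ refl)) , inj₂ (sym (⊕-cancel₂ u -e₁ e₁ refl))
  lemma u 1ℙ (inj₁ refl) (inj₁ refl) = u ⊕ -e₁ ⊕ -e₂ , inj₁ refl , inj₁ refl
  lemma u 1ℙ (inj₂ refl) (inj₁ refl) =
    u ⊕ -e₁ , inj₁ refl , inj₂ (sym (⊕-cancel₂ (u ⊕ -e₁) -e₂ e₂ refl))
  lemma u 1ℙ (inj₁ refl) (inj₂ refl) =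
    u ⊕ -e₂ , inj₂ (trans (sym (⊕-cancel₂ (u ⊕ -e₂) -e₁ e₁ refl)) (cong (_⊕ e₁) (⊕-swap u -e₂ -e₁))) , inj₁ refl
  lemma u 1ℙ (inj₂ refl) (inj₂ refl) =
    u , inj₂ (sym (⊕-cancel₂ u -e₁ e₁ refl)) , inj₂ (sym (⊕-cancel₂ u -e₂ e₂ refl))

-- Tilings and height functions

src-across : ∀ p k → colour p ≡ 0ℙ → src (across p k) ≡ source p k
src-across p left   eq = trans (horizontal-src (p ⊕ -e₁) (colour-⊕′ p -e₁ eq)) (⊕-cancel₂ p -e₁ e₁ refl)
src-across p top    eq = vertical-src p eq
src-across p right  eq = trans (horizontal-src p eq) (sym (⊕-assoc p e₁ e₂))
src-across p bottom eq = trans (vertical-src (p ⊕ -e₂) (colour-⊕′ p -e₂ eq)) (⊕-assoc p -e₂ e₁₂)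

tgt-across : ∀ p k → colour p ≡ 0ℙ → tgt (across p k) ≡ target p k
tgt-across p left   eq = trans (horizontal-tgt (p ⊕ -e₁) (colour-⊕′ p -e₁ eq)) (⊕-assoc p -e₁ e₁₂)
tgt-across p top    eq = trans (vertical-tgt p eq) (sym (⊕-assoc p e₁ e₂))
tgt-across p right  eq = horizontal-tgt p eq
tgt-across p bottom eq = trans (vertical-tgt (p ⊕ -e₂) (colour-⊕′ p -e₂ eq)) (⊕-cancel₂ p -e₂ e₂ refl)

src-across′ : ∀ p k → colour p ≡ 1ℙ → src (across p k) ≡ target p k
src-across′ p left   eq = trans (horizontal-src (p ⊕ -e₁) (colour-⊕′ p -e₁ eq)) (⊕-assoc p -e₁ e₁₂)
src-across′ p top    eq = trans (vertical-src p eq) (sym (⊕-assoc p e₁ e₂))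
src-across′ p right  eq = horizontal-src p eq
src-across′ p bottom eq = trans (vertical-src (p ⊕ -e₂) (colour-⊕′ p -e₂ eq)) (⊕-cancel₂ p -e₂ e₂ refl)

tgt-across′ : ∀ p k → colour p ≡ 1ℙ → tgt (across p k) ≡ source p k
tgt-across′ p left   eq = trans (horizontal-tgt (p ⊕ -e₁) (colour-⊕′ p -e₁ eq)) (⊕-cancel₂ p -e₁ e₁ refl)
tgt-across′ p top    eq = vertical-tgt p eq
tgt-across′ p right  eq = trans (horizontal-tgt p eq) (sym (⊕-assoc p e₁ e₂))
tgt-across′ p bottom eq = trans (vertical-tgt (p ⊕ -e₂) (colour-⊕′ p -e₂ eq)) (⊕-assoc p -e₂ e₁₂)

across-covers : ∀ p k → p ∈ squaresOf (across p k)
across-covers p left   = inj₂ (sym (⊕-cancel₂ p -e₁ e₁ refl))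
across-covers p top    = inj₁ refl
across-covers p right  = inj₁ refl
across-covers p bottom = inj₂ (sym (⊕-cancel₂ p -e₂ e₂ refl))

covers⇒across : ∀ d {p} → p ∈ squaresOf d → ∃[ k ] d ≡ across p k
covers⇒across (horizontal q) (inj₁ refl) = right , refl
covers⇒across (horizontal q) (inj₂ refl) = left , cong horizontal (sym (⊕-cancel₂ q e₁ -e₁ refl))
covers⇒across (vertical   q) (inj₁ refl) = top , refl
covers⇒across (vertical   q) (inj₂ refl) = bottom , cong vertical (sym (⊕-cancel₂ q e₂ -e₂ refl))

-- The axioms of `IsHeightFunction` speak of sides of black squares only; this form lets them be
-- applied to the edge of an arbitrary domino.
blackSquare : ∀ d → ∃[ s ] ∃[ k ] colour s ≡ 0ℙ × d ≡ across s k
blackSquare (horizontal p) = lemma (colour p) refl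
  where
  lemma : ∀ π → colour p ≡ π → ∃[ s ] ∃[ k ] colour s ≡ 0ℙ × horizontal p ≡ across s k
  lemma 0ℙ eq = p , right , eq , refl
  lemma 1ℙ eq = p ⊕ e₁ , left , colour-⊕′ p e₁ eq , cong horizontal (sym (⊕-cancel₂ p e₁ -e₁ refl))
blackSquare (vertical p) = lemma (colour p) refl
  where
  lemma : ∀ π → colour p ≡ π → ∃[ s ] ∃[ k ] colour s ≡ 0ℙ × vertical p ≡ across s k
  lemma 0ℙ eq = p , top , eq , refl
  lemma 1ℙ eq = p ⊕ e₂ , bottom , colour-⊕′ p e₂ eq , cong vertical (sym (⊕-cancel₂ p e₂ -e₂ refl))

-- Functions with increments 1 and -3, and their tilings

rise : Bool → ℤ
rise false = + 1
rise true  = ℤ.- + 3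

Dips : (ℤ² → ℤ) → Pred Domino 0ℓ
Dips g d = g (tgt d) ≡ g (src d) ℤ.- + 3

-- Height functions freed from a given tiling and from the normalisation at the origin; the tiling
-- is recovered as `Dips g`.
Steep : (ℤ² → ℤ) → Set
Steep g = ∀ d → ∃[ b ] g (tgt d) ≡ g (src d) ℤ.+ rise b

rise-injective : ∀ {x b c} → x ℤ.+ rise b ≡ x ℤ.+ rise c → b ≡ c
rise-injective {x} {b} {c} eq = lemma b c (ℤ+.∙-cancelˡ x (rise b) (rise c) eq)
  where
  lemma : ∀ b c → rise b ≡ rise c → b ≡ c
  lemma false false _ = refl
  lemma true  true  _ = refl
  lemma false true  ()
  lemma true  false ()

dips? : ∀ g d → Dec (Dips g d)
dips? g d = g (tgt d) ℤ.≟ g (src d) ℤ.- + 3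

¬dips⇒+1 : ∀ {g} → Steep g → ∀ {d} → ¬ Dips g d → g (tgt d) ≡ g (src d) ℤ.+ + 1
¬dips⇒+1 steep {d} ¬dip with steep d
... | false , eq = eq
... | true  , eq = contradiction eq ¬dip

+1⇒¬dips : ∀ {g d} → g (tgt d) ≡ g (src d) ℤ.+ + 1 → ¬ Dips g d
+1⇒¬dips {g} {d} eq dip with () ← rise-injective {g (src d)} {false} {true} (trans (sym eq) dip)

-- If m of the four terms are -3 and the others 1, the sum is 4 - 4m, which vanishes only for m = 1.
oneDip : (β : Side → Bool) → ((rise (β left) ℤ.+ rise (β top)) ℤ.+ rise (β right)) ℤ.+ rise (β bottom) ≡ 0ℤ →
         ∃[ k ] β k ≡ true × (∀ k′ → β k′ ≡ true → k′ ≡ k)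
oneDip β eq = lemma (β left) (β top) (β right) (β bottom) refl refl refl refl eq
  where
  lemma : ∀ a b c d → β left ≡ a → β top ≡ b → β right ≡ c → β bottom ≡ d →
          ((rise a ℤ.+ rise b) ℤ.+ rise c) ℤ.+ rise d ≡ 0ℤ →
          ∃[ k ] β k ≡ true × (∀ k′ → β k′ ≡ true → k′ ≡ k)
  clash : ∀ {k k′} → β k ≡ false → β k ≡ true → k ≡ k′
  clash p q with () ← trans (sym p) q
  lemma true false false false pa pb pc pd _ = left , pa , λ where
    left   q → refl
    top    q → clash pb q
    right  q → clash pc q
    bottom q → clash pd q
  lemma false true false false pa pb pc pd _ = top , pb , λ where
    left   q → clash pa q
    top    q → refl
    right  q → clash pc q
    bottom q → clash pd q
  lemma false false true false pa pb pc pd _ = right , pc , λ where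
    left   q → clash pa q
    top    q → clash pb q
    right  q → refl
    bottom q → clash pd q
  lemma false false false true pa pb pc pd _ = bottom , pd , λ where
    left   q → clash pa q
    top    q → clash pb q
    right  q → clash pc q
    bottom q → refl
  lemma true true true true _ _ _ _ ()
  lemma true true true false _ _ _ _ ()
  lemma true true false true _ _ _ _ ()
  lemma true true false false _ _ _ _ ()
  lemma true false true true _ _ _ _ ()
  lemma true false true false _ _ _ _ ()
  lemma true false false true _ _ _ _ ()
  lemma false true true true _ _ _ _ ()
  lemma false true true false _ _ _ _ ()
  lemma false true false true _ _ _ _ ()
  lemma false false true true _ _ _ _ ()
  lemma false false false false _ _ _ _ ()

cycle : ∀ w {x y z a b c d} → x ≡ w ℤ.+ a → y ≡ x ℤ.+ b → z ≡ y ℤ.+ c → w ≡ z ℤ.+ d →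
        ((a ℤ.+ b) ℤ.+ c) ℤ.+ d ≡ 0ℤ
cycle w {a = a} {b} {c} {d} refl refl refl eq = ℤ+.∙-cancelˡ w _ _ $
  trans (lemma w a b c d) (trans (sym eq) (sym (ℤ.+-identityʳ w)))
  where
  lemma : ∀ w a b c d → w ℤ.+ (((a ℤ.+ b) ℤ.+ c) ℤ.+ d) ≡ (((w ℤ.+ a) ℤ.+ b) ℤ.+ c) ℤ.+ d
  lemma = solve-∀

module _ {g : ℤ² → ℤ} (steep : Steep g) where

  private
    bit : ℤ² → Side → Bool
    bit p k = proj₁ (steep (across p k))

  dip⇒bit : ∀ p k → Dips g (across p k) → bit p k ≡ true
  dip⇒bit p k dip = rise-injective {g (src (across p k))} (trans (sym (proj₂ (steep (across p k)))) dip)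

  bit⇒dip : ∀ p k → bit p k ≡ true → Dips g (across p k)
  bit⇒dip p k eq = trans (proj₂ (steep (across p k))) (cong (λ b → g (src (across p k)) ℤ.+ rise b) eq)

  cycle-rise : ∀ p → ((rise (bit p left) ℤ.+ rise (bit p top)) ℤ.+ rise (bit p right)) ℤ.+ rise (bit p bottom) ≡ 0ℤ
  cycle-rise p = lemma (colour p) refl
    where
    lemma : ∀ π → colour p ≡ π →
            ((rise (bit p left) ℤ.+ rise (bit p top)) ℤ.+ rise (bit p right)) ℤ.+ rise (bit p bottom) ≡ 0ℤ
    lemma 0ℙ eq = cycle (g p) (step left) (step top) (step right) (step bottom)
      where
      step : ∀ k → g (target p k) ≡ g (source p k) ℤ.+ rise (bit p k)
      step k = subst₂ (λ t s → g t ≡ g s ℤ.+ rise (bit p k)) (tgt-across p k eq) (src-across p k eq)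
                      (proj₂ (steep (across p k)))
    -- The boundary of a white square is oriented counterclockwise, so its sides are traversed in
    -- the opposite order.
    lemma 1ℙ eq = trans (reverse (rise (bit p left)) (rise (bit p top)) (rise (bit p right)) (rise (bit p bottom)))
                        (cycle (g p) (step bottom) (step right) (step top) (step left))
      where
      step : ∀ k → g (source p k) ≡ g (target p k) ℤ.+ rise (bit p k)
      step k = subst₂ (λ t s → g t ≡ g s ℤ.+ rise (bit p k)) (tgt-across′ p k eq) (src-across′ p k eq)
                      (proj₂ (steep (across p k)))
      reverse : ∀ a b c d → ((a ℤ.+ b) ℤ.+ c) ℤ.+ d ≡ ((d ℤ.+ c) ℤ.+ b) ℤ.+ a
      reverse = solve-∀

  -- The increments around a unit square cancel, so exactly one of its sides dips, and the domino
  -- across that side is the only one to cover the square.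
  dips-isTiling : IsTiling (Dips g)
  dips-isTiling = record { covering = covering ; disjoint = disjoint }
    where
    covering : ∀ s → ∃[ d ] d ∈ Dips g × s ∈ squaresOf d
    covering s with k , eq , _ ← oneDip (bit s) (cycle-rise s) =
      across s k , bit⇒dip s k eq , across-covers s k
    disjoint : ∀ {d d′ s} → d ∈ Dips g → d′ ∈ Dips g → s ∈ squaresOf d → s ∈ squaresOf d′ → d ≡ d′
    disjoint {d} {d′} {s} dip dip′ s∈d s∈d′
      with k , refl ← covers⇒across d s∈d
         | k′ , refl ← covers⇒across d′ s∈d′
         | _ , _ , unique ← oneDip (bit s) (cycle-rise s) =
      cong (across s) (trans (unique k (dip⇒bit s k dip)) (sym (unique k′ (dip⇒bit s k′ dip′))))

  ¬dips-incoming : ∀ {d d′} → tgt d ≡ src d′ → Dips g d′ → ¬ Dips g d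
  ¬dips-incoming {d} {d′} eq dip′ dip
    with s , s∈d , s∈d′ ← shared-square d d′ eq
    with refl ← IsTiling.disjoint dips-isTiling {d} {d′} dip dip′ s∈d s∈d′ =
    -- The two dominoes now coincide, so the edge of `d` would begin and end at one vertex, although
    -- its ends differ in colour.
    ℙ.p≢p⁻¹ (colour (tgt d)) (trans (colour-tgt d) (cong (_⁻¹ ∘ colour) (sym eq)))

-- Subtraction-free form of: g (u ⊕ v) - g u does not depend on u.
QuasiPeriodic : Pred ℤ² 0ℓ → (ℤ² → ℤ) → Set
QuasiPeriodic L g = ∀ {v} → v ∈ L → ∀ u u′ → g (u ⊕ v) ℤ.+ g u′ ≡ g (u′ ⊕ v) ℤ.+ g u

src-translate : ∀ {v} → colour v ≡ 0ℙ → ∀ d → src (translate v d) ≡ src d ⊕ v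
src-translate {v} eq (horizontal p) = trans
  (horizontal-src (p ⊕ v) (trans (colour-⊕ p v) (cong (ℙ._+ colour p) eq))) (⊕-swap p v (end hor (colour p)))
src-translate {v} eq (vertical   p) = trans
  (vertical-src (p ⊕ v) (trans (colour-⊕ p v) (cong (ℙ._+ colour p) eq))) (⊕-swap p v (end ver (colour p)))

tgt-translate : ∀ {v} → colour v ≡ 0ℙ → ∀ d → tgt (translate v d) ≡ tgt d ⊕ v
tgt-translate {v} eq (horizontal p) = trans
  (horizontal-tgt (p ⊕ v) (trans (colour-⊕ p v) (cong (ℙ._+ colour p) eq))) (⊕-swap p v (end hor (colour p ⁻¹)))
tgt-translate {v} eq (vertical   p) = trans
  (vertical-tgt (p ⊕ v) (trans (colour-⊕ p v) (cong (ℙ._+ colour p) eq))) (⊕-swap p v (end ver (colour p ⁻¹)))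

transfer : ∀ a b c d r → a ℤ.+ d ≡ c ℤ.+ b → b ≡ d ℤ.+ r → a ≡ c ℤ.+ r
transfer a _ c d r eq refl = ℤ+.∙-cancelʳ d a (c ℤ.+ r) (trans eq (lemma c d r))
  where
  lemma : ∀ c d r → c ℤ.+ (d ℤ.+ r) ≡ c ℤ.+ r ℤ.+ d
  lemma = solve-∀

-- Translation by a vector of even colour carries oriented edges to oriented edges, and
-- quasi-periodicity leaves the increment along them unchanged.
dips-periodic : ∀ {L g} → (∀ v → v ∈ L → colour v ≡ 0ℙ) → QuasiPeriodic L g → Periodic L (Dips g)
dips-periodic {L} {g} even qp {v} v∈L = (λ {d} → to d) , (λ {d} → from d)
  where
  module _ (d : Domino) where
    s t : ℤ²
    s = src d
    t = tgt d
    to : Dips g d → Dips g (translate v d)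
    to dip = subst₂ (λ t s → g t ≡ g s ℤ.- + 3) (sym (tgt-translate (even v v∈L) d)) (sym (src-translate (even v v∈L) d))
      (transfer (g (t ⊕ v)) (g t) (g (s ⊕ v)) (g s) (ℤ.- + 3) (qp v∈L t s) dip)
    from : Dips g (translate v d) → Dips g d
    from dip = transfer (g t) (g (t ⊕ v)) (g s) (g (s ⊕ v)) (ℤ.- + 3)
      (trans (ℤ.+-comm (g t) (g (s ⊕ v))) (trans (sym (qp v∈L t s)) (ℤ.+-comm (g (t ⊕ v)) (g s))))
      (subst₂ (λ t s → g t ≡ g s ℤ.- + 3) (tgt-translate (even v v∈L) d) (src-translate (even v v∈L) d) dip)

tilingOf : ∀ {L g} → (∀ v → v ∈ L → colour v ≡ 0ℙ) → Steep g → QuasiPeriodic L g → TorusTiling L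
tilingOf {L} {g} even steep qp = record
  { dominoes = Dips g
  ; isTiling = dips-isTiling {g} steep
  ; periodic = λ {v} → dips-periodic {L} {g} even qp {v}
  }

infix 4 _≟ᴰ_

_≟ᴰ_ : DecidableEquality Domino
horizontal p ≟ᴰ horizontal q = map′ (cong horizontal) (λ { refl → refl }) (Product.≡-dec ℤ._≟_ ℤ._≟_ p q)
vertical   p ≟ᴰ vertical   q = map′ (cong vertical) (λ { refl → refl }) (Product.≡-dec ℤ._≟_ ℤ._≟_ p q)
horizontal p ≟ᴰ vertical   q = no λ ()
vertical   p ≟ᴰ horizontal q = no λ ()

-- Although `t` is an arbitrary predicate, `covering` computes the domino of `t` on a given square
-- of `d`, and by disjointness `d` lies in `t` only if it is that one.
_∈ᵀ?_ : ∀ {t} d → IsTiling t → Dec (d ∈ t)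
_∈ᵀ?_ {t} d tiling
  with s , k , _ , refl ← blackSquare d
  with d′ , d′∈t , s∈d′ ← IsTiling.covering tiling s
  with d ≟ᴰ d′
... | yes refl = yes d′∈t
... | no  d≢d′ = no λ d∈t → d≢d′ (IsTiling.disjoint tiling d∈t d′∈t (across-covers s k) s∈d′)

module _ {t h} (tiling : IsTiling t) (height : IsHeightFunction t h) where
  open IsHeightFunction height

  private
    rises : ∀ d → d ∈ t × Dips h d ⊎ d ∉ t × h (tgt d) ≡ h (src d) ℤ.+ + 1
    rises d with s , k , black , refl ← blackSquare d
      with src-across s k black | tgt-across s k black | across s k ∈ᵀ? tiling
    ... | eq | eq′ | yes d∈t = inj₁ (d∈t , subst₂ (λ v u → h v ≡ h u ℤ.- + 3) (sym eq′) (sym eq)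
                                              (stepOver s k (colour⇒black {s} black) d∈t))
    ... | eq | eq′ | no  d∉t = inj₂ (d∉t , subst₂ (λ v u → h v ≡ h u ℤ.+ + 1) (sym eq′) (sym eq)
                                              (step s k (colour⇒black {s} black) d∉t))

  height-steep : Steep h
  height-steep d with rises d
  ... | inj₁ (_ , eq) = true , eq
  ... | inj₂ (_ , eq) = false , eq

  height-dips : t ≐ Dips h
  height-dips = (λ {d} → to d) , (λ {d} → from d)
    where
    to : ∀ d → d ∈ t → Dips h d
    to d d∈t with rises d
    ... | inj₁ (_ , dip) = dip
    ... | inj₂ (d∉t , _) = contradiction d∈t d∉t
    from : ∀ d → Dips h d → d ∈ t
    from d dip with rises d
    ... | inj₁ (d∈t , _) = d∈t
    ... | inj₂ (_ , eq)  = contradiction dip (+1⇒¬dips {h} {d} eq)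

-- Descending by flips

-- What the descent uses of a lattice. Decidability serves to lower a function on one orbit; the
-- finite list `reps`, which may meet a class repeatedly, serves the pigeonhole argument and the
-- termination measure.
record EvenCocompact (L : Pred ℤ² 0ℓ) : Set where
  field
    ⊕-closed : ∀ {v w} → v ∈ L → w ∈ L → v ⊕ w ∈ L
    ⊖-closed : ∀ {v} → v ∈ L → ⊖ v ∈ L
    even     : ∀ v → v ∈ L → colour v ≡ 0ℙ
    _∈?      : ∀ v → Dec (v ∈ L)
    reps     : List ℤ²
    reduce   : ∀ u → ∃[ r ] ∃[ v ] r ∈ˡ reps × v ∈ L × u ≡ r ⊕ v

sum-map-≤ : ∀ {A : Set} {f g : A → ℕ} xs → (∀ x → f x ℕ.≤ g x) → sum (map f xs) ℕ.≤ sum (map g xs)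
sum-map-≤ []       f≤g = z≤n
sum-map-≤ (x ∷ xs) f≤g = ℕ.+-mono-≤ (f≤g x) (sum-map-≤ xs f≤g)

sum-map-< : ∀ {A : Set} {f g : A → ℕ} {x xs} → (∀ x → f x ℕ.≤ g x) → x ∈ˡ xs → f x ℕ.< g x →
            sum (map f xs) ℕ.< sum (map g xs)
sum-map-< {xs = _ ∷ xs} f≤g (here refl)  fx<gx = ℕ.+-mono-<-≤ fx<gx (sum-map-≤ xs f≤g)
sum-map-< {xs = y ∷ _}  f≤g (there x∈xs) fx<gx = ℕ.+-mono-≤-< (f≤g y) (sum-map-< f≤g x∈xs fx<gx)

-- Values of `D` in ℕ build in that the lifted function never falls below `h`.
lift : (ℤ² → ℤ) → (ℤ² → ℕ) → ℤ² → ℤ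
lift h D u = h u ℤ.+ + 4 ℤ.* + D u

PeriodicMap : Pred ℤ² 0ℓ → (ℤ² → ℕ) → Set
PeriodicMap L D = ∀ {v} → v ∈ L → ∀ u → D (u ⊕ v) ≡ D u

-- What φ ∈ int Q means for height functions, with k shifted by 1 so that it
-- is positive.
Gentle : Pred ℤ² 0ℓ → (ℤ² → ℤ) → Set
Gentle L h = ∀ k {a b} → (a , b) ∈ L → ∣ a ∣ ℕ.≤ suc k → ∣ b ∣ ℕ.≤ suc k →
             ∀ u → ¬ h (u ⊕ (a , b)) ≡ h u ℤ.+ + (suc k ℕ.* 2)

-- Climbing to a peak

Peak : (ℤ² → ℤ) → Pred ℤ² 0ℓ
Peak g v = ∀ d → src d ≡ v → Dips g d

pair-members : ∀ o u → ∃[ d ] ∃[ d′ ] pair o u d × pair o u d′ × (∀ x → pair o u x → x ≡ d ⊎ x ≡ d′)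
pair-members hor u = _ , _ , inj₁ refl , inj₂ refl , λ _ x → x
pair-members ver u = _ , _ , inj₁ refl , inj₂ refl , λ _ x → x

peak⊎climb : ∀ g u → Peak g u ⊎ (∃[ d ] src d ≡ u × ¬ Dips g d)
peak⊎climb g u
  with d , d′ , d∈ , d′∈ , only ← pair-members (around (colour u)) u
  with dips? g d | dips? g d′
... | no ¬dip | _       = inj₂ (d , outgoing⇒src u d∈ , ¬dip)
... | yes _   | no ¬dip = inj₂ (d′ , outgoing⇒src u d′∈ , ¬dip)
... | yes dip | yes dip′ = inj₁ λ { x refl → [ (λ { refl → dip }) , (λ { refl → dip′ }) ]′ (only x (src-outgoing x)) }

move : ∀ d → (colour (src d) ≡ 0ℙ × ∃[ y ] ∣ y ∣ ≡ 1 × tgt d ≡ src d ⊕ (0ℤ , y))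
           ⊎ (colour (src d) ≡ 1ℙ × ∃[ x ] ∣ x ∣ ≡ 1 × tgt d ≡ src d ⊕ (x , 0ℤ))
move (horizontal p) = inj₁ (lemma (colour p) refl)
  where
  lemma : ∀ π → colour p ≡ π → colour (p ⊕ end hor π) ≡ 0ℙ ×
          ∃[ y ] ∣ y ∣ ≡ 1 × p ⊕ end hor (π ⁻¹) ≡ p ⊕ end hor π ⊕ (0ℤ , y)
  lemma 0ℙ eq = colour-⊕′ p e₁₂ eq , -1ℤ , refl , sym (⊕-assoc p e₁₂ -e₂)
  lemma 1ℙ eq = colour-⊕′ p e₁ eq , 1ℤ , refl , sym (⊕-assoc p e₁ e₂)
move (vertical p) = inj₂ (lemma (colour p) refl)
  where
  lemma : ∀ π → colour p ≡ π → colour (p ⊕ end ver π) ≡ 1ℙ ×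
          ∃[ x ] ∣ x ∣ ≡ 1 × p ⊕ end ver (π ⁻¹) ≡ p ⊕ end ver π ⊕ (x , 0ℤ)
  lemma 0ℙ eq = colour-⊕′ p e₂ eq , 1ℤ , refl , sym (⊕-assoc p e₂ e₁)
  lemma 1ℙ eq = colour-⊕′ p e₁₂ eq , -1ℤ , refl , sym (⊕-assoc p e₁₂ -e₁)

Far : (ℤ² → ℤ) → ℕ → ℤ² → ℤ² → Set
Far g k u w = ∃[ a ] ∃[ b ] ∣ a ∣ ℕ.≤ k × ∣ b ∣ ℕ.≤ k × w ≡ u ⊕ (a , b) × g w ≡ g u ℤ.+ + (k ℕ.* 2)

far-zero : ∀ g u → Far g 0 u u
far-zero g u = 0ℤ , 0ℤ , z≤n , z≤n , sym (⊕-identityʳ u) , sym (ℤ.+-identityʳ (g u))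

far-trans : ∀ {g k l u v w} → Far g k u v → Far g l v w → Far g (k ℕ.+ l) u w
far-trans {g} {k} {l} {u} (a , b , a≤ , b≤ , refl , eq) (c , d , c≤ , d≤ , refl , eq′) =
  a ℤ.+ c , b ℤ.+ d ,
  ℕ.≤-trans (ℤ.∣i+j∣≤∣i∣+∣j∣ a c) (ℕ.+-mono-≤ a≤ c≤) ,
  ℕ.≤-trans (ℤ.∣i+j∣≤∣i∣+∣j∣ b d) (ℕ.+-mono-≤ b≤ d≤) ,
  ⊕-assoc u (a , b) (c , d) ,
  (begin
    g (u ⊕ (a , b) ⊕ (c , d))                   ≡⟨ eq′ ⟩
    g (u ⊕ (a , b)) ℤ.+ + (l ℕ.* 2)             ≡⟨ cong (ℤ._+ + (l ℕ.* 2)) eq ⟩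
    g u ℤ.+ + (k ℕ.* 2) ℤ.+ + (l ℕ.* 2)         ≡⟨ ℤ.+-assoc (g u) (+ (k ℕ.* 2)) (+ (l ℕ.* 2)) ⟩
    g u ℤ.+ + (k ℕ.* 2 ℕ.+ l ℕ.* 2)             ≡⟨ cong (λ n → g u ℤ.+ + n) (ℕ.*-distribʳ-+ 2 k l) ⟨
    g u ℤ.+ + ((k ℕ.+ l) ℕ.* 2)                 ∎)
  where open ≡-Reasoning

far-along : ∀ {g n} (f : ℕ → ℤ²) → (∀ i → i ℕ.< n → Far g 1 (f i) (f (suc i))) →
            ∀ k i → i ℕ.+ k ℕ.≤ n → Far g k (f i) (f (i ℕ.+ k))
far-along {g} f fars zero i i≤n   = subst (λ j → Far g 0 (f i) (f j)) (sym (ℕ.+-identityʳ i)) (far-zero g (f i))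
far-along {g} {n} f fars (suc k) i i+k≤n = subst (λ j → Far g (suc k) (f i) (f j)) (sym (ℕ.+-suc i k))
  (far-trans {g} {1} {k} (fars i (ℕ.≤-trans (s≤s (ℕ.m≤m+n i k)) i+k<n)) (far-along {g} f fars k (suc i) i+k<n))
  where
  i+k<n : suc i ℕ.+ k ℕ.≤ n
  i+k<n = subst (ℕ._≤ n) (ℕ.+-suc i k) i+k≤n

-- Uncrossed edges out of successive vertices are alternately vertical and
-- horizontal.
far-two-steps : ∀ {g} d d′ → tgt d ≡ src d′ → ¬ Dips g d → ¬ Dips g d′ → Steep g → Far g 1 (src d) (tgt d′)
far-two-steps {g} d d′ eq ¬dip ¬dip′ steep = lemma (move d) (move d′)
  where
  height : g (tgt d′) ≡ g (src d) ℤ.+ + 2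
  height = begin
    g (tgt d′)                   ≡⟨ ¬dips⇒+1 {g} steep {d′} ¬dip′ ⟩
    g (src d′) ℤ.+ + 1           ≡⟨ cong (λ u → g u ℤ.+ + 1) eq ⟨
    g (tgt d) ℤ.+ + 1            ≡⟨ cong (ℤ._+ + 1) (¬dips⇒+1 {g} steep {d} ¬dip) ⟩
    g (src d) ℤ.+ + 1 ℤ.+ + 1    ≡⟨ ℤ.+-assoc (g (src d)) (+ 1) (+ 1) ⟩
    g (src d) ℤ.+ + 2            ∎
    where open ≡-Reasoning
  colours : ∀ π → colour (src d) ≡ π → ¬ colour (src d′) ≡ π
  colours π p q =
    ℙ.p≢p⁻¹ π (trans (sym (trans (cong colour eq) q)) (trans (colour-tgt d) (cong _⁻¹ p)))
  combine : ∀ v w x y → v ⊕ w ≡ (x , y) → ∣ x ∣ ≡ 1 → ∣ y ∣ ≡ 1 → tgt d ≡ src d ⊕ v → tgt d′ ≡ src d′ ⊕ w →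
            Far g 1 (src d) (tgt d′)
  combine v w x y vw px py p q = x , y , ℕ.≤-reflexive px , ℕ.≤-reflexive py ,
    trans q (trans (cong (_⊕ w) (trans (sym eq) p)) (trans (⊕-assoc (src d) v w) (cong (src d ⊕_) vw))) , height
  lemma : _ → _ → Far g 1 (src d) (tgt d′)
  lemma (inj₁ (c , y , py , p)) (inj₂ (c′ , x , px , q)) =
    combine (0ℤ , y) (x , 0ℤ) x y (cong₂ _,_ (ℤ.+-identityˡ x) (ℤ.+-identityʳ y)) px py p q
  lemma (inj₂ (c , x , px , p)) (inj₁ (c′ , y , py , q)) =
    combine (x , 0ℤ) (0ℤ , y) x y (cong₂ _,_ (ℤ.+-identityʳ x) (ℤ.+-identityˡ y)) px py p q
  lemma (inj₁ (c , _)) (inj₁ (c′ , _)) = contradiction c′ (colours 0ℙ c)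
  lemma (inj₂ (c , _)) (inj₂ (c′ , _)) = contradiction c′ (colours 1ℙ c)

module _ {h D} (steep-h : Steep h) (steep : Steep (lift h D)) where

  private g = lift h D

  -- Along an uncrossed edge g rises by 1, which is the most that h can rise.
  excess-grows : ∀ {d} → ¬ Dips g d → 0 ℕ.< D (src d) → 0 ℕ.< D (tgt d)
  excess-grows {d} ¬dip D>0 with steep-h d | ¬dips⇒+1 {g} steep {d} ¬dip
  ... | b , eq | eq′ = lemma (D (tgt d)) refl
    where
    lemma : ∀ n → D (tgt d) ≡ n → 0 ℕ.< D (tgt d)
    lemma (suc n) p = subst (0 ℕ.<_) (sym p) z<s
    -- If `D` vanished at the target, `h` would rise along the edge by 4 times the value of `D` at
    -- the source plus 1, which is at least 5.
    lemma zero    p = contradiction (ℤ+.∙-cancelˡ (h (src d)) (rise b) (+ 4 ℤ.* + D (src d) ℤ.+ + 1) (begin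
      h (src d) ℤ.+ rise b                          ≡⟨ eq ⟨
      h (tgt d)                                     ≡⟨ ℤ.+-identityʳ (h (tgt d)) ⟨
      h (tgt d) ℤ.+ + 4 ℤ.* + 0                     ≡⟨ cong (λ n → h (tgt d) ℤ.+ + 4 ℤ.* + n) p ⟨
      g (tgt d)                                     ≡⟨ eq′ ⟩
      h (src d) ℤ.+ + 4 ℤ.* + D (src d) ℤ.+ + 1     ≡⟨ ℤ.+-assoc (h (src d)) (+ 4 ℤ.* + D (src d)) (+ 1) ⟩
      h (src d) ℤ.+ (+ 4 ℤ.* + D (src d) ℤ.+ + 1)   ∎)) (absurd b D>0)
      where
      open ≡-Reasoning
      absurd : ∀ b {n} → 0 ℕ.< n → ¬ rise b ≡ + 4 ℤ.* + n ℤ.+ + 1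
      absurd false {suc n} _ eq with () ← ℤ+.∙-cancelʳ (+ 1) 0ℤ (+ 4 ℤ.* + suc n) eq
      absurd true  {suc n} _ ()

  HighPeak : Set
  HighPeak = ∃[ v ] 0 ℕ.< D v × Peak g v

  -- Edges are taken in pairs because a vertical and a horizontal one together change each
  -- coordinate by exactly 1 for a rise of 2. This ratio is what the bound ½ in `Q` is compared
  -- with.
  leap : ∀ u → 0 ℕ.< D u → HighPeak ⊎ (∃[ w ] 0 ℕ.< D w × Far g 1 u w)
  leap u D>0 with peak⊎climb g u
  ... | inj₁ peak = inj₁ (u , D>0 , peak)
  ... | inj₂ (d , refl , ¬dip) with peak⊎climb g (tgt d)
  ... | inj₁ peak = inj₁ (tgt d , excess-grows ¬dip D>0 , peak)
  ... | inj₂ (d′ , eq , ¬dip′) = inj₂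
    (tgt d′ , excess-grows ¬dip′ (subst (λ u → 0 ℕ.< D u) (sym eq) (excess-grows ¬dip D>0)) ,
     far-two-steps {g} d d′ (sym eq) ¬dip ¬dip′ steep)

  climb : ∀ n u → 0 ℕ.< D u → HighPeak ⊎ (Σ[ f ∈ (ℕ → ℤ²) ] f 0 ≡ u × (∀ i → i ℕ.< n → Far g 1 (f i) (f (suc i))))
  -- Only the values of `f` up to index `n` matter; beyond them it stays constant.
  climb zero    u D>0 = inj₂ ((λ _ → u) , refl , λ _ ())
  climb (suc n) u D>0 with leap u D>0
  ... | inj₁ peak = inj₁ peak
  ... | inj₂ (w , D>0′ , far) with climb n w D>0′
  ... | inj₁ peak = inj₁ peak
  ... | inj₂ (f , refl , fars) = inj₂
    ((λ { zero → u ; (suc i) → f i }) , refl , λ { zero _ → far ; (suc i) (s<s i<n) → fars i i<n })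

module _ {L} (lattice : EvenCocompact L) where
  open EvenCocompact lattice

  lift-quasiPeriodic : ∀ {h D} → QuasiPeriodic L h → PeriodicMap L D → QuasiPeriodic L (lift h D)
  lift-quasiPeriodic {h} {D} qp per {v} v∈L u u′ = begin
    h (u ⊕ v) ℤ.+ + 4 ℤ.* + D (u ⊕ v) ℤ.+ (h u′ ℤ.+ + 4 ℤ.* + D u′)
      ≡⟨ cong (λ n → h (u ⊕ v) ℤ.+ + 4 ℤ.* + n ℤ.+ (h u′ ℤ.+ + 4 ℤ.* + D u′)) (per v∈L u) ⟩
    h (u ⊕ v) ℤ.+ + 4 ℤ.* + D u ℤ.+ (h u′ ℤ.+ + 4 ℤ.* + D u′)
      ≡⟨ exchange (h (u ⊕ v)) (h u′) (h (u′ ⊕ v)) (h u) (+ 4 ℤ.* + D u) (+ 4 ℤ.* + D u′) (qp v∈L u u′) ⟩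
    h (u′ ⊕ v) ℤ.+ + 4 ℤ.* + D u′ ℤ.+ (h u ℤ.+ + 4 ℤ.* + D u)
      ≡⟨ cong (λ n → h (u′ ⊕ v) ℤ.+ + 4 ℤ.* + n ℤ.+ (h u ℤ.+ + 4 ℤ.* + D u)) (per v∈L u′) ⟨
    h (u′ ⊕ v) ℤ.+ + 4 ℤ.* + D (u′ ⊕ v) ℤ.+ (h u ℤ.+ + 4 ℤ.* + D u) ∎
    where
    open ≡-Reasoning
    collect : ∀ a b x y → a ℤ.+ x ℤ.+ (b ℤ.+ y) ≡ (a ℤ.+ b) ℤ.+ (x ℤ.+ y)
    collect = solve-∀
    spread : ∀ c d x y → (c ℤ.+ d) ℤ.+ (x ℤ.+ y) ≡ c ℤ.+ y ℤ.+ (d ℤ.+ x)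
    spread = solve-∀
    exchange : ∀ a b c d x y → a ℤ.+ b ≡ c ℤ.+ d → a ℤ.+ x ℤ.+ (b ℤ.+ y) ≡ c ℤ.+ y ℤ.+ (d ℤ.+ x)
    exchange a b c d x y eq = trans (collect a b x y) (trans (cong (ℤ._+ (x ℤ.+ y)) eq) (spread c d x y))

  class : ℤ² → Fin (length reps)
  class u = Any.index (proj₁ (proj₂ (proj₂ (reduce u))))

  class⇒L : ∀ u u′ → class u ≡ class u′ → ∃[ w ] w ∈ L × u′ ≡ u ⊕ w
  class⇒L u u′ = lemma (reduce u) (reduce u′)
    where
    lemma : (ρ  : ∃[ r ] ∃[ v ] r ∈ˡ reps × v ∈ L × u ≡ r ⊕ v)
            (ρ′ : ∃[ r ] ∃[ v ] r ∈ˡ reps × v ∈ L × u′ ≡ r ⊕ v) →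
            Any.index (proj₁ (proj₂ (proj₂ ρ))) ≡ Any.index (proj₁ (proj₂ (proj₂ ρ′))) →
            ∃[ w ] w ∈ L × u′ ≡ u ⊕ w
    lemma (r , v , r∈ , v∈L , refl) (r′ , v′ , r′∈ , v′∈L , refl) same =
      ⊖ v ⊕ v′ , ⊕-closed (⊖-closed v∈L) v′∈L , (begin
        r′ ⊕ v′                ≡⟨ cong (_⊕ v′) r≡r′ ⟨
        r ⊕ v′                 ≡⟨ cong (_⊕ v′) (p⊕q⊕⊖q≡p r v) ⟨
        r ⊕ v ⊕ ⊖ v ⊕ v′       ≡⟨ ⊕-assoc (r ⊕ v) (⊖ v) v′ ⟩
        r ⊕ v ⊕ (⊖ v ⊕ v′)     ∎)
      where
      open ≡-Reasoning
      r≡r′ : r ≡ r′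
      r≡r′ = trans (lookup-index r∈) (trans (cong (lookup reps) same) (sym (lookup-index r′∈)))

  -- The term `4 D` is periodic and cancels in the gain along a vector of `L`, so the lifted
  -- function inherits the gentleness of `h`.
  gentle⇒¬far : ∀ {h D k u u′ w} → Gentle L h → PeriodicMap L D → w ∈ L → u′ ≡ u ⊕ w → ¬ Far (lift h D) (suc k) u u′
  gentle⇒¬far {h} {D} {k} {u} {w = w} gentle per w∈L refl (a , b , a≤ , b≤ , eq , rises)
    with refl ← ⊕-cancelˡ u {w} {a , b} eq = gentle k w∈L a≤ b≤ u (begin
      h (u ⊕ w)                                         ≡⟨ undo (h (u ⊕ w)) (+ 4 ℤ.* + D u) ⟩
      h (u ⊕ w) ℤ.+ + 4 ℤ.* + D u ℤ.- + 4 ℤ.* + D u     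
        ≡⟨ cong (λ n → h (u ⊕ w) ℤ.+ + 4 ℤ.* + n ℤ.- + 4 ℤ.* + D u) (per w∈L u) ⟨
      lift h D (u ⊕ w) ℤ.- + 4 ℤ.* + D u                ≡⟨ cong (ℤ._- + 4 ℤ.* + D u) rises ⟩
      h u ℤ.+ + 4 ℤ.* + D u ℤ.+ + (suc k ℕ.* 2) ℤ.- + 4 ℤ.* + D u
                                                        ≡⟨ undo′ (h u) (+ 4 ℤ.* + D u) (+ (suc k ℕ.* 2)) ⟩
      h u ℤ.+ + (suc k ℕ.* 2)                           ∎)
    where
    open ≡-Reasoning
    undo : ∀ x y → x ≡ x ℤ.+ y ℤ.- y
    undo = solve-∀
    undo′ : ∀ x y z → x ℤ.+ y ℤ.+ z ℤ.- y ≡ x ℤ.+ z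
    undo′ = solve-∀

  highPeak : ∀ {h D} → Steep h → Steep (lift h D) → PeriodicMap L D → Gentle L h →
             ∀ u → 0 ℕ.< D u → ∃[ v ] 0 ℕ.< D v × Peak (lift h D) v
  highPeak {h} {D} steep-h steep per gentle u D>0 = lemma (climb {h} {D} steep-h steep (length reps) u D>0)
    where
    ¬collision : (f : ℕ → ℤ²) → (∀ i → i ℕ.< length reps → Far (lift h D) 1 (f i) (f (suc i))) →
                 ∀ {i j} → i ℕ.< j → j ℕ.≤ length reps → ¬ class (f i) ≡ class (f j)
    ¬collision f fars {i} i<j j≤n same with k , refl ← ℕ.m≤n⇒∃[o]m+o≡n i<j
      with w , w∈L , eq ← class⇒L (f i) (f (suc i ℕ.+ k)) same =
      gentle⇒¬far {h} {D} {k} {f i} {f (suc i ℕ.+ k)} gentle per w∈L eq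
        (subst (λ j → Far (lift h D) (suc k) (f i) (f j)) (ℕ.+-suc i k)
          (far-along {lift h D} f fars (suc k) i (ℕ.≤-trans (ℕ.≤-reflexive (ℕ.+-suc i k)) j≤n)))
    lemma : _ → ∃[ v ] 0 ℕ.< D v × Peak (lift h D) v
    lemma (inj₁ peak) = peak
    lemma (inj₂ (f , _ , fars))
      -- `length reps` leaps visit `suc (length reps)` vertices, one more than there are classes.
      with i , j , i<j , same ← Fin.pigeonhole (ℕ.n<1+n (length reps)) (λ i → class (f (toℕ i))) =
      contradiction same (¬collision f fars i<j (ℕ.s≤s⁻¹ (Fin.toℕ<n j)))

  -- Lowering an orbit by one flip

  Orbit : ℤ² → Pred ℤ² 0ℓ
  Orbit v u = ∃[ w ] w ∈ L × u ≡ v ⊕ w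

  orbit? : ∀ v u → Dec (Orbit v u)
  orbit? v u = map′ (λ w∈L → u ⊕ ⊖ v , w∈L , sym (trans (⊕-comm v (u ⊕ ⊖ v)) (p⊕⊖q⊕q≡p u v)))
                    (λ { (w , w∈L , refl) → subst (_∈ L) (sym (trans (cong (_⊕ ⊖ v) (⊕-comm v w)) (p⊕q⊕⊖q≡p w v))) w∈L })
                    ((u ⊕ ⊖ v) ∈?)

  orbit-colour : ∀ {v u} → Orbit v u → colour u ≡ colour v
  orbit-colour {v} (w , w∈L , refl) = trans (colour-⊕ v w) (cong (ℙ._+ colour v) (even w w∈L))

  orbit-⊕ : ∀ {v u w} → w ∈ L → Orbit v u → Orbit v (u ⊕ w)
  orbit-⊕ {v} {w = w} w∈L (x , x∈L , refl) = x ⊕ w , ⊕-closed x∈L w∈L , ⊕-assoc v x w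

  orbit-⊕⁻ : ∀ {v u w} → w ∈ L → Orbit v (u ⊕ w) → Orbit v u
  orbit-⊕⁻ {v} {u} {w} w∈L o = subst (Orbit v) (p⊕q⊕⊖q≡p u w) (orbit-⊕ {v} {u ⊕ w} (⊖-closed w∈L) o)

  -- The truncation in `pred` is harmless: by periodicity `D` is positive on the whole orbit once it
  -- is positive at `v`.
  lower : ℤ² → (ℤ² → ℕ) → ℤ² → ℕ
  lower v D u with orbit? v u
  ... | yes _ = pred (D u)
  ... | no  _ = D u

  lower-∈ : ∀ v D {u} → Orbit v u → lower v D u ≡ pred (D u)
  lower-∈ v D {u} o with orbit? v u
  ... | yes _ = refl
  ... | no ¬o = contradiction o ¬o

  lower-∉ : ∀ v D {u} → ¬ Orbit v u → lower v D u ≡ D u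
  lower-∉ v D {u} ¬o with orbit? v u
  ... | yes o = contradiction o ¬o
  ... | no  _ = refl

  lower-≤ : ∀ v D u → lower v D u ℕ.≤ D u
  lower-≤ v D u with orbit? v u
  ... | yes _ = ℕ.pred[n]≤n
  ... | no  _ = ℕ.≤-refl

  lower-periodic : ∀ v {D} → PeriodicMap L D → PeriodicMap L (lower v D)
  lower-periodic v {D} per {w} w∈L u with orbit? v u
  ... | yes o = trans (lower-∈ v D (orbit-⊕ {v} {u} w∈L o)) (cong pred (per w∈L u))
  ... | no ¬o = trans (lower-∉ v D (¬o ∘ orbit-⊕⁻ {v} {u} w∈L)) (per w∈L u)

  weight : (ℤ² → ℕ) → ℕ
  weight D = sum (map D reps)

  -- The representative of `v` lies in the lowered orbit, so its term drops strictly, while no term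
  -- grows.
  weight-lower : ∀ v {D} → PeriodicMap L D → 0 ℕ.< D v → weight (lower v D) ℕ.< weight D
  weight-lower v {D} per D>0 with r , w , r∈ , w∈L , refl ← reduce v =
    sum-map-< {f = lower v D} {g = D} (lower-≤ v D) r∈
      (subst (ℕ._< D r) (sym (lower-∈ v D r∈orbit)) (pred<  (subst (0 ℕ.<_) (per w∈L r) D>0)))
    where
    r∈orbit : Orbit (r ⊕ w) r
    r∈orbit = ⊖ w , ⊖-closed w∈L , sym (p⊕q⊕⊖q≡p r w)
    pred< : ∀ {n} → 0 ℕ.< n → pred n ℕ.< n
    pred< {suc n} _ = ℕ.n<1+n n

  lift-lower-∉ : ∀ v h D {u} → ¬ Orbit v u → lift h (lower v D) u ≡ lift h D u
  lift-lower-∉ v h D {u} ¬o = cong (λ n → h u ℤ.+ + 4 ℤ.* + n) (lower-∉ v D ¬o)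

  lift-lower-∈ : ∀ v h {D u} → PeriodicMap L D → 0 ℕ.< D v → Orbit v u →
                 lift h D u ≡ lift h (lower v D) u ℤ.+ + 4
  lift-lower-∈ v h {D} per D>0 o@(w , w∈L , refl) = begin
    h (v ⊕ w) ℤ.+ + 4 ℤ.* + D (v ⊕ w)                       ≡⟨ lemma (h (v ⊕ w)) (subst (0 ℕ.<_) (sym (per w∈L v)) D>0) ⟩
    h (v ⊕ w) ℤ.+ + 4 ℤ.* + pred (D (v ⊕ w)) ℤ.+ + 4        ≡⟨ cong (λ n → h (v ⊕ w) ℤ.+ + 4 ℤ.* + n ℤ.+ + 4) (lower-∈ v D o) ⟨
    h (v ⊕ w) ℤ.+ + 4 ℤ.* + lower v D (v ⊕ w) ℤ.+ + 4       ∎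
    where
    open ≡-Reasoning
    ring : ∀ x y → x ℤ.+ + 4 ℤ.* (+ 1 ℤ.+ y) ≡ x ℤ.+ + 4 ℤ.* y ℤ.+ + 4
    ring = solve-∀
    lemma : ∀ x {n} → 0 ℕ.< n → x ℤ.+ + 4 ℤ.* + n ≡ x ℤ.+ + 4 ℤ.* + pred n ℤ.+ + 4
    lemma x {suc n} _ = ring x (+ n)

  -- `pairs` uses one orientation for the whole orbit, while `outgoing` reads it off at each vertex;
  -- they agree because an orbit has a single colour. The same holds for the next three lemmas.
  outgoing-orbit : ∀ {v d} → pairs L (around (colour v)) v d → Orbit v (src d)
  outgoing-orbit {v} {d} (w , w∈L , d∈) = w , w∈L , outgoing⇒src (v ⊕ w)
    (subst (λ π → pair (around π) (v ⊕ w) d) (sym (orbit-colour {v} (w , w∈L , refl))) d∈)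

  incoming-orbit : ∀ {v d} → pairs L (opposite (around (colour v))) v d → Orbit v (tgt d)
  incoming-orbit {v} {d} (w , w∈L , d∈) = w , w∈L , incoming⇒tgt (v ⊕ w)
    (subst (λ π → pair (opposite (around π)) (v ⊕ w) d) (sym (orbit-colour {v} (w , w∈L , refl))) d∈)

  orbit-outgoing : ∀ {v d} → Orbit v (src d) → pairs L (around (colour v)) v d
  orbit-outgoing {v} {d} o@(w , w∈L , eq) = w , w∈L ,
    subst₂ (λ π u → pair (around π) u d) (orbit-colour {v} o) eq (src-outgoing d)

  orbit-incoming : ∀ {v d} → Orbit v (tgt d) → pairs L (opposite (around (colour v))) v d
  orbit-incoming {v} {d} o@(w , w∈L , eq) = w , w∈L ,
    subst₂ (λ π u → pair (opposite (around π)) u d) (orbit-colour {v} o) eq (tgt-incoming d)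

  module FlipAt {h D v} (steep : Steep (lift h D)) (qp : QuasiPeriodic L h) (per : PeriodicMap L D)
                (D>0 : 0 ℕ.< D v) (peak : Peak (lift h D) v) where

    g g⁻ : ℤ² → ℤ
    g  = lift h D
    g⁻ = lift h (lower v D)

    src∈⇒dips : ∀ {d} → Orbit v (src d) → Dips g d
    src∈⇒dips {d} (w , w∈L , eq) = proj₂ (dips-periodic {L} {g} even (lift-quasiPeriodic {h} {D} qp per) (⊖-closed w∈L))
      (peak (translate (⊖ w) d)
        (trans (src-translate (even (⊖ w) (⊖-closed w∈L)) d) (trans (cong (_⊕ ⊖ w) eq) (p⊕q⊕⊖q≡p v w))))

    -- The edges out of `tgt d` dip, and their dominoes already fill the 2 × 2 square round it,
    -- leaving no room for one across an incoming edge.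
    tgt∈⇒¬dips : ∀ {d} → Orbit v (tgt d) → ¬ Dips g d
    tgt∈⇒¬dips {d} o with d′ , _ , d′∈ , _ ← pair-members (around (colour (tgt d))) (tgt d) =
      ¬dips-incoming {g} steep {d} {d′} (sym eq) (src∈⇒dips {d′} (subst (Orbit v) (sym eq) o))
      where
      eq : src d′ ≡ tgt d
      eq = outgoing⇒src (tgt d) d′∈

    src∈⇒tgt∉ : ∀ {d} → Orbit v (src d) → ¬ Orbit v (tgt d)
    src∈⇒tgt∉ {d} o o′ = tgt∈⇒¬dips {d} o′ (src∈⇒dips {d} o)

    -- Lowering by 4 at the source turns -3 into +1, and at the target +1 into -3. No edge has both
    -- ends lowered, so these cases and the untouched edges are all.
    data Change (d : Domino) : Set where
      removed   : Orbit v (src d) → g⁻ (tgt d) ≡ g⁻ (src d) ℤ.+ + 1 → Change d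
      added     : Orbit v (tgt d) → Dips g⁻ d → Change d
      unchanged : ¬ Orbit v (src d) → ¬ Orbit v (tgt d) →
                  g⁻ (tgt d) ≡ g (tgt d) → g⁻ (src d) ≡ g (src d) → Change d

    change : ∀ d → Change d
    change d with orbit? v (src d) | orbit? v (tgt d)
    ... | yes o | _ = removed o (begin
      g⁻ (tgt d)                         ≡⟨ lift-lower-∉ v h D (src∈⇒tgt∉ {d} o) ⟩
      g (tgt d)                          ≡⟨ src∈⇒dips {d} o ⟩
      g (src d) ℤ.- + 3                  ≡⟨ cong (ℤ._- + 3) (lift-lower-∈ v h per D>0 o) ⟩
      g⁻ (src d) ℤ.+ + 4 ℤ.- + 3         ≡⟨ ℤ.+-assoc (g⁻ (src d)) (+ 4) (ℤ.- + 3) ⟩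
      g⁻ (src d) ℤ.+ + 1                 ∎)
      where open ≡-Reasoning
    ... | no ¬o | yes o = added o (begin
      g⁻ (tgt d)                         ≡⟨ ℤ.+-identityʳ (g⁻ (tgt d)) ⟨
      g⁻ (tgt d) ℤ.+ 0ℤ                  ≡⟨ ℤ.+-assoc (g⁻ (tgt d)) (+ 4) (ℤ.- + 4) ⟨
      g⁻ (tgt d) ℤ.+ + 4 ℤ.- + 4         ≡⟨ cong (ℤ._- + 4) (lift-lower-∈ v h per D>0 o) ⟨
      g (tgt d) ℤ.- + 4                  ≡⟨ cong (ℤ._- + 4) (¬dips⇒+1 {g} steep {d} (tgt∈⇒¬dips {d} o)) ⟩
      g (src d) ℤ.+ + 1 ℤ.- + 4          ≡⟨ ℤ.+-assoc (g (src d)) (+ 1) (ℤ.- + 4) ⟩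
      g (src d) ℤ.- + 3                  ≡⟨ cong (ℤ._- + 3) (lift-lower-∉ v h D ¬o) ⟨
      g⁻ (src d) ℤ.- + 3                 ∎)
      where open ≡-Reasoning
    ... | no ¬o | no ¬o′ = unchanged ¬o ¬o′ (lift-lower-∉ v h D ¬o′) (lift-lower-∉ v h D ¬o)

    steep⁻ : Steep g⁻
    steep⁻ d with change d
    ... | removed _ eq = false , eq
    ... | added _ dip  = true , dip
    ... | unchanged _ _ p q with steep d
    ... | b , eq = b , trans p (trans eq (cong (ℤ._+ rise b) (sym q)))

    flipped : TorusTiling L
    flipped = tilingOf {L} {g⁻} even steep⁻ (lift-quasiPeriodic {h} {lower v D} qp (lower-periodic v per))

    flip : ∀ t → dominoes t ≐ Dips g → Flip L t flipped
    flip t (t⊆ , ⊆t) = v , around (colour v) ,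
      (λ {d} d∈ → ⊆t {d} (peak d (outgoing⇒src v d∈))) , (λ {d} → to d) , (λ {d} → from d)
      where
      Expected : Pred Domino 0ℓ
      Expected = (dominoes t ∖ pairs L (around (colour v)) v) ∪ pairs L (opposite (around (colour v))) v
      to : ∀ d → Dips g⁻ d → Expected d
      to d dip with change d
      ... | removed _ eq = contradiction dip (+1⇒¬dips {g⁻} {d} eq)
      ... | added o _    = inj₂ (orbit-incoming {v} {d} o)
      ... | unchanged ¬o _ p q = inj₁ (⊆t {d} (trans (sym p) (trans dip (cong (ℤ._- + 3) q))) , ¬o ∘ outgoing-orbit {v} {d})
      from : ∀ d → Expected d → Dips g⁻ d
      from d d∈ with change d | d∈
      ... | removed o _ | inj₁ (_ , d∉) = contradiction (orbit-outgoing {v} {d} o) d∉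
      ... | removed o _ | inj₂ d∈⁺ = contradiction (incoming-orbit {v} {d} d∈⁺) (src∈⇒tgt∉ {d} o)
      ... | added _ dip | _ = dip
      ... | unchanged _ ¬o _ _ | inj₂ d∈⁺ = contradiction (incoming-orbit {v} {d} d∈⁺) ¬o
      ... | unchanged _ _ p q | inj₁ (d∈t , _) = trans p (trans (t⊆ {d} d∈t) (cong (ℤ._- + 3) (sym q)))

  -- `Flip` determines its result only up to `≐`, so the last flip of a path can be made to end at
  -- the prescribed tiling itself.
  flip-≈ : ∀ {t s s′} → Flip L t s → s ≈ s′ → Flip L t s′
  flip-≈ (v , o , pair⊆ , s⊆ , ⊆s) (to , from) = v , o , pair⊆ , (λ {d} x → s⊆ {d} (from {d} x)) , (λ {d} x → to {d} (⊆s {d} x))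

  -- Iterating the flips

  module _ {h} (steep-h : Steep h) (qp : QuasiPeriodic L h) (gentle : Gentle L h) where

    record Above (t : TorusTiling L) (n : ℕ) : Set where
      field
        excess    : ℤ² → ℕ
        invariant : PeriodicMap L excess
        steep     : Steep (lift h excess)
        tiles     : dominoes t ≐ Dips (lift h excess)
        bound     : weight excess ℕ.< n

    descent : ∀ {t n} → (above : Above t (suc n)) → ∀ {u} → 0 ℕ.< Above.excess above u →
              ∃[ s ] Flip L t s × Above s n
    descent {t} above {u} D>0 = lemma (highPeak {h} {D} steep-h steep per gentle u D>0)
      where
      open Above above using (steep; tiles; bound) renaming (excess to D; invariant to per)
      lemma : (∃[ v ] 0 ℕ.< D v × Peak (lift h D) v) → _
      lemma (v , D>0 , peak) = flipped , flip t tiles , record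
        { excess   = lower v D
        ; invariant = lower-periodic v per
        ; steep    = steep⁻
        ; tiles    = id , id
        ; bound    = ℕ.≤-trans (weight-lower v per D>0) (ℕ.s≤s⁻¹ bound)
        }
        where open FlipAt {h} {D} {v} steep qp per D>0 peak

    level⇒≈ : ∀ {t t′ n} → (above : Above t n) → (∀ u → Above.excess above u ≡ 0) → dominoes t′ ≐ Dips h → t ≈ t′
    level⇒≈ {t} {t′} above D≡0 (t′⊆ , ⊆t′) =
      (λ {d} x → ⊆t′ {d} (subst₂ _≡_ (lift≡ (tgt d)) (cong (ℤ._- + 3) (lift≡ (src d))) (proj₁ tiles {d} x))) ,
      (λ {d} x → proj₂ tiles {d} (subst₂ _≡_ (sym (lift≡ (tgt d))) (cong (ℤ._- + 3) (sym (lift≡ (src d)))) (t′⊆ {d} x)))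
      where
      open Above above using (tiles) renaming (excess to D)
      lift≡ : ∀ u → lift h D u ≡ h u
      lift≡ u = trans (cong (λ n → h u ℤ.+ + 4 ℤ.* + n) (D≡0 u)) (ℤ.+-identityʳ (h u))

    level? : ∀ {t n} → (above : Above t n) →
             (∃[ u ] 0 ℕ.< Above.excess above u) ⊎ (∀ u → Above.excess above u ≡ 0)
    level? above with any? (λ r → 0 ℕ.<? Above.excess above r) reps
    ... | yes some = inj₁ (map₂ proj₂ (find some))
    ... | no D≤0   = inj₂ λ u → let r , v , r∈ , v∈L , eq = reduce u in
      trans (cong D eq) (trans (invariant v∈L r) (ℕ.n≤0⇒n≡0 (ℕ.≮⇒≥ (λ D>0 → D≤0 (lose r∈ D>0)))))
      where open Above above using (invariant) renaming (excess to D)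

    -- The empty path joins a tiling only to itself, whereas the descent reaches `t′` up to `≈`; the
    -- case without flips is therefore kept apart. The strict bound on the weight makes `n` the
    -- recursion argument.
    descend : ∀ n {t t′} → Above t n → dominoes t′ ≐ Dips h → t ≈ t′ ⊎ Star (Flip L) t t′
    descend zero    above _ with () ← Above.bound above
    descend (suc n) {t} {t′} above t′≐ = [ below , (λ D≡0 → inj₁ (level⇒≈ {t} {t′} above D≡0 t′≐)) ]′ (level? above)
      where
      extend : ∀ {s} → Flip L t s → s ≈ t′ ⊎ Star (Flip L) s t′ → Star (Flip L) t t′
      extend {s} flip (inj₁ same) = flip-≈ {t} {s} {t′} flip same ◅ ε
      extend     flip (inj₂ path) = flip ◅ path
      below : (∃[ u ] 0 ℕ.< Above.excess above u) → t ≈ t′ ⊎ Star (Flip L) t t′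
      below (u , D>0) = let s , flip , above′ = descent above {u} D>0 in
        inj₂ (extend {s} flip (descend n {s} {t′} above′ t′≐))

-- Lattices

det : ℤ² → ℤ² → ℤ
det (a , b) (c , d) = a ℤ.* d ℤ.- b ℤ.* c

-- With coefficients taken from the vectors themselves, two combinations of them equal (0 , -Δ) and
-- (Δ , 0). If Δ = 0, independence kills the coefficients `a` and `b`, so the first vector is zero,
-- which is again dependent.
det≢0 : ∀ b c → LinearlyIndependent b c → det b c ≢ 0ℤ
det≢0 (a , b) (c , d) independent Δ≡0 = case proj₁ (independent 1ℤ 0ℤ (begin
    1ℤ · (a , b) ⊕ 0ℤ · (c , d)  ≡⟨ cong₂ (λ x y → 1ℤ · (x , y) ⊕ 0ℤ · (c , d)) a≡0 b≡0 ⟩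
    𝟎                            ∎)) of λ ()
  where
  open ≡-Reasoning
  x₁ : ∀ a b c d → c ℤ.* a ℤ.+ (ℤ.- a) ℤ.* c ≡ 0ℤ
  x₁ = solve-∀
  y₁ : ∀ a b c d → c ℤ.* b ℤ.+ (ℤ.- a) ℤ.* d ≡ ℤ.- (a ℤ.* d ℤ.- b ℤ.* c)
  y₁ = solve-∀
  x₂ : ∀ a b c d → d ℤ.* a ℤ.+ (ℤ.- b) ℤ.* c ≡ a ℤ.* d ℤ.- b ℤ.* c
  x₂ = solve-∀
  y₂ : ∀ a b c d → d ℤ.* b ℤ.+ (ℤ.- b) ℤ.* d ≡ 0ℤ
  y₂ = solve-∀
  a≡0 : a ≡ 0ℤ
  a≡0 = ℤ.neg-injective (proj₂ (independent c (ℤ.- a) (cong₂ _,_ (x₁ a b c d) (trans (y₁ a b c d) (cong ℤ.-_ Δ≡0)))))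
  b≡0 : b ≡ 0ℤ
  b≡0 = ℤ.neg-injective (proj₂ (independent d (ℤ.- b) (cong₂ _,_ (trans (x₂ a b c d) Δ≡0) (y₂ a b c d))))

cramer : ∀ b c m n → det (m · b ⊕ n · c) c ≡ m ℤ.* det b c × det b (m · b ⊕ n · c) ≡ n ℤ.* det b c
cramer (a , b) (c , d) m n = ring₁ a b c d m n , ring₂ a b c d m n
  where
  ring₁ : ∀ a b c d m n → (m ℤ.* a ℤ.+ n ℤ.* c) ℤ.* d ℤ.- (m ℤ.* b ℤ.+ n ℤ.* d) ℤ.* c ≡ m ℤ.* (a ℤ.* d ℤ.- b ℤ.* c)
  ring₁ = solve-∀
  ring₂ : ∀ a b c d m n → a ℤ.* (m ℤ.* b ℤ.+ n ℤ.* d) ℤ.- b ℤ.* (m ℤ.* a ℤ.+ n ℤ.* c) ≡ n ℤ.* (a ℤ.* d ℤ.- b ℤ.* c)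
  ring₂ = solve-∀

-- Cramer's rule cleared of denominators; it puts every multiple of the determinant into the
-- lattice.
det-· : ∀ b c p → det b c · p ≡ det p c · b ⊕ det b p · c
det-· (a , b) (c , d) (p , q) = cong₂ _,_ (ring₁ a b c d p q) (ring₂ a b c d p q)
  where
  ring₁ : ∀ a b c d p q → (a ℤ.* d ℤ.- b ℤ.* c) ℤ.* p ≡ (p ℤ.* d ℤ.- q ℤ.* c) ℤ.* a ℤ.+ (a ℤ.* q ℤ.- b ℤ.* p) ℤ.* c
  ring₁ = solve-∀
  ring₂ : ∀ a b c d p q → (a ℤ.* d ℤ.- b ℤ.* c) ℤ.* q ≡ (p ℤ.* d ℤ.- q ℤ.* c) ℤ.* b ℤ.+ (a ℤ.* q ℤ.- b ℤ.* p) ℤ.* d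
  ring₂ = solve-∀

·-cancelˡ : ∀ k {p q} → k ≢ 0ℤ → k · p ≡ k · q → p ≡ q
·-cancelˡ k {a , b} {c , d} k≢0 eq =
  cong₂ _,_ (ℤ.*-cancelˡ-≡ k a c {{ℤ.≢-nonZero k≢0}} (cong proj₁ eq)) (ℤ.*-cancelˡ-≡ k b d {{ℤ.≢-nonZero k≢0}} (cong proj₂ eq))

coordinateSum : ℤ² → ℤ
coordinateSum (a , b) = a ℤ.+ b

𝓔⊔𝓞-even : ∀ {p} → p ∈ 𝓔 ∪ 𝓞 → ∃[ r ] coordinateSum p ≡ + 2 ℤ.* r
𝓔⊔𝓞-even (inj₁ ((a , b) , refl)) = a ℤ.+ b , ring a b
  where
  ring : ∀ a b → + 2 ℤ.* a ℤ.+ + 2 ℤ.* b ≡ + 2 ℤ.* (a ℤ.+ b)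
  ring = solve-∀
𝓔⊔𝓞-even (inj₂ ((a , b) , refl)) = a ℤ.+ b ℤ.+ 1ℤ , ring a b
  where
  ring : ∀ a b → (+ 2 ℤ.* a ℤ.+ + 1) ℤ.+ (+ 2 ℤ.* b ℤ.+ + 1) ≡ + 2 ℤ.* (a ℤ.+ b ℤ.+ + 1)
  ring = solve-∀

span-⊕ : ∀ b c m n m′ n′ → (m · b ⊕ n · c) ⊕ (m′ · b ⊕ n′ · c) ≡ (m ℤ.+ m′) · b ⊕ (n ℤ.+ n′) · c
span-⊕ (a , b) (c , d) m n m′ n′ = cong₂ _,_ (ring a c m n m′ n′) (ring b d m n m′ n′)
  where
  ring : ∀ a c m n m′ n′ → (m ℤ.* a ℤ.+ n ℤ.* c) ℤ.+ (m′ ℤ.* a ℤ.+ n′ ℤ.* c) ≡ (m ℤ.+ m′) ℤ.* a ℤ.+ (n ℤ.+ n′) ℤ.* c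
  ring = solve-∀

span-⊖ : ∀ b c m n → ⊖ (m · b ⊕ n · c) ≡ (ℤ.- m) · b ⊕ (ℤ.- n) · c
span-⊖ (a , b) (c , d) m n = cong₂ _,_ (ring a c m n) (ring b d m n)
  where
  ring : ∀ a c m n → ℤ.- (m ℤ.* a ℤ.+ n ℤ.* c) ≡ (ℤ.- m) ℤ.* a ℤ.+ (ℤ.- n) ℤ.* c
  ring = solve-∀

span-even : ∀ b c m n {r s} → coordinateSum b ≡ + 2 ℤ.* r → coordinateSum c ≡ + 2 ℤ.* s → colour (m · b ⊕ n · c) ≡ 0ℙ
span-even (a , b) (c , d) m n {r} {s} p q = begin
  parity ∣ (m ℤ.* a ℤ.+ n ℤ.* c) ℤ.+ (m ℤ.* b ℤ.+ n ℤ.* d) ∣ ≡⟨ cong (parity ∘ ∣_∣) (ring₁ a b c d m n) ⟩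
  parity ∣ m ℤ.* (a ℤ.+ b) ℤ.+ n ℤ.* (c ℤ.+ d) ∣             ≡⟨ cong₂ (λ x y → parity ∣ m ℤ.* x ℤ.+ n ℤ.* y ∣) p q ⟩
  parity ∣ m ℤ.* (+ 2 ℤ.* r) ℤ.+ n ℤ.* (+ 2 ℤ.* s) ∣         ≡⟨ cong (parity ∘ ∣_∣) (ring₂ r s m n) ⟩
  parity ∣ + 2 ℤ.* (m ℤ.* r ℤ.+ n ℤ.* s) ∣                   ≡⟨ cong parity (ℤ.abs-* (+ 2) (m ℤ.* r ℤ.+ n ℤ.* s)) ⟩
  parity (2 ℕ.* ∣ m ℤ.* r ℤ.+ n ℤ.* s ∣)                     ≡⟨ ℙ.*-homo-* 2 ∣ m ℤ.* r ℤ.+ n ℤ.* s ∣ ⟩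
  0ℙ                                                         ∎
  where
  open ≡-Reasoning
  ring₁ : ∀ a b c d m n → (m ℤ.* a ℤ.+ n ℤ.* c) ℤ.+ (m ℤ.* b ℤ.+ n ℤ.* d) ≡ m ℤ.* (a ℤ.+ b) ℤ.+ n ℤ.* (c ℤ.+ d)
  ring₁ = solve-∀
  ring₂ : ∀ r s m n → m ℤ.* (+ 2 ℤ.* r) ℤ.+ n ℤ.* (+ 2 ℤ.* s) ≡ + 2 ℤ.* (m ℤ.* r ℤ.+ n ℤ.* s)
  ring₂ = solve-∀

module _ {L} (valid : ValidLattice L) where
  open ValidLattice valid

  private
    Δ : ℤ
    Δ = det b₁ b₂

    Δ≢0 : Δ ≢ 0ℤ
    Δ≢0 = det≢0 b₁ b₂ independent

    instance
      Δ-nonZero : ℤ.NonZero Δ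
      Δ-nonZero = ℤ.≢-nonZero Δ≢0

    to : ∀ {p} → p ∈ L → p ∈ ⟨ b₁ , b₂ ⟩
    to {p} = proj₁ generated {p}

    from : ∀ {p} → p ∈ ⟨ b₁ , b₂ ⟩ → p ∈ L
    from {p} = proj₂ generated {p}

  det∈L : ∀ p → Δ · p ∈ L
  det∈L p = from (det p b₂ , det b₁ p , det-· b₁ b₂ p)

  -- The coordinates of `p` in the basis are two determinants divided by `Δ`, so membership amounts
  -- to two divisibility tests.
  _∈L? : ∀ p → Dec (p ∈ L)
  p ∈L? = map′ (λ (d , d′) → from (divisible d d′)) (λ p∈L → divisors (to p∈L))
               ((Δ ℤ.∣? det p b₂) ×-dec (Δ ℤ.∣? det b₁ p))
    where
    open ≡-Reasoning
    divisible : (Δ ∣ det p b₂) → (Δ ∣ det b₁ p) → p ∈ ⟨ b₁ , b₂ ⟩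
    divisible (divides m eq) (divides n eq′) = m , n , ·-cancelˡ Δ Δ≢0 (begin
      Δ · p                                    ≡⟨ det-· b₁ b₂ p ⟩
      det p b₂ · b₁ ⊕ det b₁ p · b₂            ≡⟨ cong₂ (λ x y → x · b₁ ⊕ y · b₂) eq eq′ ⟩
      (m ℤ.* Δ) · b₁ ⊕ (n ℤ.* Δ) · b₂          ≡⟨ ring b₁ b₂ m n Δ ⟩
      Δ · (m · b₁ ⊕ n · b₂)                    ∎)
      where
      ring₁ : ∀ a c m n k → (m ℤ.* k) ℤ.* a ℤ.+ (n ℤ.* k) ℤ.* c ≡ k ℤ.* (m ℤ.* a ℤ.+ n ℤ.* c)
      ring₁ = solve-∀
      ring : ∀ b c m n k → (m ℤ.* k) · b ⊕ (n ℤ.* k) · c ≡ k · (m · b ⊕ n · c)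
      ring (a , b) (c , d) m n k = cong₂ _,_ (ring₁ a c m n k) (ring₁ b d m n k)
    divisors : p ∈ ⟨ b₁ , b₂ ⟩ → (Δ ∣ det p b₂) × (Δ ∣ det b₁ p)
    divisors (m , n , refl) = divides m (proj₁ (cramer b₁ b₂ m n)) , divides n (proj₂ (cramer b₁ b₂ m n))

  evenCocompact : EvenCocompact L
  evenCocompact = record
    { ⊕-closed = λ {v} {w} v∈L w∈L → addition (to v∈L) (to w∈L)
    ; ⊖-closed = λ {v} v∈L → negation (to v∈L)
    ; even     = λ v v∈L → even (to v∈L)
    ; _∈?      = _∈L?
    -- Since `Δ · p` always lies in `L`, both coordinates can be reduced modulo `Δ`. The resulting
    -- box may contain several points of one class.
    ; reps     = cartesianProductWith (λ i j → + i , + j) (upTo ∣ Δ ∣) (upTo ∣ Δ ∣)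
    ; reduce   = λ (x , y) → (+ (x ℤ.% Δ) , + (y ℤ.% Δ)) , Δ · (x ℤ./ Δ , y ℤ./ Δ) ,
                   ∈-cartesianProductWith⁺ (λ i j → + i , + j) (∈-upTo⁺ (ℤ.n%d<d x Δ)) (∈-upTo⁺ (ℤ.n%d<d y Δ)) ,
                   det∈L (x ℤ./ Δ , y ℤ./ Δ) , cong₂ _,_ (division x) (division y)
    }
    where
    addition : ∀ {v w} → v ∈ ⟨ b₁ , b₂ ⟩ → w ∈ ⟨ b₁ , b₂ ⟩ → v ⊕ w ∈ L
    addition (m , n , refl) (m′ , n′ , refl) = from (m ℤ.+ m′ , n ℤ.+ n′ , span-⊕ b₁ b₂ m n m′ n′)
    negation : ∀ {v} → v ∈ ⟨ b₁ , b₂ ⟩ → ⊖ v ∈ L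
    negation (m , n , refl) = from (ℤ.- m , ℤ.- n , span-⊖ b₁ b₂ m n)
    even : ∀ {v} → v ∈ ⟨ b₁ , b₂ ⟩ → colour v ≡ 0ℙ
    even (m , n , refl) = span-even b₁ b₂ m n (proj₂ (𝓔⊔𝓞-even b₁∈𝓔⊔𝓞)) (proj₂ (𝓔⊔𝓞-even b₂∈𝓔⊔𝓞))
    division : ∀ x → x ≡ + (x ℤ.% Δ) ℤ.+ Δ ℤ.* (x ℤ./ Δ)
    division x = trans (ℤ.a≡a%n+[a/n]*n x Δ) (cong (λ z → + (x ℤ.% Δ) ℤ.+ z) (ℤ.*-comm (x ℤ./ Δ) Δ))

-- Flux

-- `fromℤ` normalises by a gcd that is stuck on a variable; here the reduced fraction is given
-- directly, so its numerator computes.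
integer : ℤ → ℚ
integer n = ℚ.mkℚ n 0 (Coprime.sym (Coprime.1-coprimeTo ∣ n ∣))

fromℤ≡integer : ∀ n → fromℤ n ≡ integer n
fromℤ≡integer n = ℚ.↥p/↧p≡p (integer n)

fromℤ-injective : ∀ {m n} → fromℤ m ≡ fromℤ n → m ≡ n
fromℤ-injective {m} {n} eq = cong ℚ.numerator (trans (sym (fromℤ≡integer m)) (trans eq (fromℤ≡integer n)))

∣fromℤ∣≤ : ∀ {a K} → ∣ a ∣ ℕ.≤ K → ℚ.∣ fromℤ a ∣ ℚ.≤ fromℤ (+ K)
∣fromℤ∣≤ {a} {K} a≤K = subst₂ (λ p q → ℚ.∣ p ∣ ℚ.≤ q) (sym (fromℤ≡integer a)) (sym (fromℤ≡integer (+ K)))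
  (ℚ.*≤* (ℤ.*-monoʳ-≤-nonNeg (+ 1) (ℤ.+≤+ a≤K)))

p≤∣p∣ : ∀ p → p ℚ.≤ ℚ.∣ p ∣
p≤∣p∣ p with ℚ.≤-total 0ℚ p
... | inj₁ 0≤p = ℚ.≤-reflexive (sym (ℚ.0≤p⇒∣p∣≡p 0≤p))
... | inj₂ p≤0 = ℚ.≤-trans p≤0 (ℚ.0≤∣p∣ p)

-p≤∣p∣ : ∀ p → ℚ.- p ℚ.≤ ℚ.∣ p ∣
-p≤∣p∣ p = subst (ℚ.- p ℚ.≤_) (ℚ.∣-p∣≡∣p∣ p) (p≤∣p∣ (ℚ.- p))

enlarge : ∀ x {δ} → 0ℚ ℚ.< δ → ∃[ x′ ] ℚ.∣ x′ ℚ.- x ∣ ≡ δ × ℚ.∣ x ∣ ℚ.< ℚ.∣ x′ ∣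
enlarge x {δ} 0<δ with ℚ.∣p∣≡p∨∣p∣≡-p x
... | inj₁ eq = x ℚ.+ δ ,
  trans (cong ℚ.∣_∣ (trans (cong (ℚ._- x) (ℚ.+-comm x δ)) (ℚ+.//-rightDividesʳ x δ)))
        (ℚ.0≤p⇒∣p∣≡p (ℚ.<⇒≤ 0<δ)) ,
  (begin-strict
    ℚ.∣ x ∣          ≡⟨ eq ⟩
    x                ≡⟨ ℚ.+-identityʳ x ⟨
    x ℚ.+ 0ℚ         <⟨ ℚ.+-monoʳ-< x 0<δ ⟩
    x ℚ.+ δ          ≤⟨ p≤∣p∣ (x ℚ.+ δ) ⟩
    ℚ.∣ x ℚ.+ δ ∣    ∎)
  where open ℚ.≤-Reasoning
... | inj₂ eq = x ℚ.- δ ,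
  trans (cong ℚ.∣_∣ (trans (cong (ℚ._- x) (ℚ.+-comm x (ℚ.- δ))) (ℚ+.//-rightDividesʳ x (ℚ.- δ))))
        (trans (ℚ.∣-p∣≡∣p∣ δ) (ℚ.0≤p⇒∣p∣≡p (ℚ.<⇒≤ 0<δ))) ,
  (begin-strict
    ℚ.∣ x ∣          ≡⟨ eq ⟩
    ℚ.- x            ≡⟨ ℚ.+-identityʳ (ℚ.- x) ⟨
    ℚ.- x ℚ.+ 0ℚ     <⟨ ℚ.+-monoʳ-< (ℚ.- x) 0<δ ⟩
    ℚ.- x ℚ.+ δ      ≡⟨ trans (ℚ.neg-distrib-+ x (ℚ.- δ)) (cong (ℚ.- x ℚ.+_) (ℚ+.⁻¹-involutive δ)) ⟨
    ℚ.- (x ℚ.- δ)    ≤⟨ -p≤∣p∣ (x ℚ.- δ) ⟩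
    ℚ.∣ x ℚ.- δ ∣    ∎)
  where open ℚ.≤-Reasoning

-- Moving `x` away from 0 by less than the radius `η` stays in `Q` and strictly increases `∣ x ∣`.
-- Density supplies a displacement strictly between 0 and `η`.
intQ⇒<½ : ∀ {x y} → (x , y) ∈ int Q → ℚ.∣ x ∣ ℚ.+ ℚ.∣ y ∣ ℚ.< ½
intQ⇒<½ {x} {y} (η , 0<η , near)
  with δ , 0<δ , δ<η ← ℚ.<-dense 0<η
  with x′ , dist , x<x′ ← enlarge x 0<δ =
  ℚ.<-≤-trans (ℚ.+-monoˡ-< ℚ.∣ y ∣ x<x′)
    (near x′ y (subst (ℚ._< η) (sym dist) δ<η)
               (subst (ℚ._< η) (sym (cong ℚ.∣_∣ (ℚ.+-inverseʳ y))) 0<η))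

-- With K = k + 1, the left side is at most 4(|x| + |y|)K, which is less than 2K; strictness rests
-- on K > 0.
flux-bound : ∀ {x y a b k} → ℚ.∣ x ∣ ℚ.+ ℚ.∣ y ∣ ℚ.< ½ → ∣ a ∣ ℕ.≤ suc k → ∣ b ∣ ℕ.≤ suc k →
             fromℤ (+ 4) ℚ.* ⟪ (x , y) , (a , b) ⟫ ≢ fromℤ (+ (suc k ℕ.* 2))
flux-bound {x} {y} {a} {b} {k} small a≤ b≤ eq = ℚ.<-irrefl eq (begin-strict
  fromℤ (+ 4) ℚ.* (x ℚ.* fromℤ a ℚ.+ y ℚ.* fromℤ b)
    ≤⟨ ℚ.*-monoˡ-≤-nonNeg (fromℤ (+ 4)) (ℚ.+-mono-≤ (term x a a≤) (term y b b≤)) ⟩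
  fromℤ (+ 4) ℚ.* (ℚ.∣ x ∣ ℚ.* K ℚ.+ ℚ.∣ y ∣ ℚ.* K)          ≡⟨ cong (fromℤ (+ 4) ℚ.*_) (ℚ.*-distribʳ-+ K ℚ.∣ x ∣ ℚ.∣ y ∣) ⟨
  fromℤ (+ 4) ℚ.* ((ℚ.∣ x ∣ ℚ.+ ℚ.∣ y ∣) ℚ.* K)              <⟨ ℚ.*-monoʳ-<-pos (fromℤ (+ 4)) (ℚ.*-monoˡ-<-pos K small) ⟩
  fromℤ (+ 4) ℚ.* (½ ℚ.* K)                                  ≡⟨ ℚ.*-assoc (fromℤ (+ 4)) ½ K ⟨
  fromℤ (+ 2) ℚ.* K                                          ≡⟨ double ⟩
  fromℤ (+ (suc k ℕ.* 2))                                    ∎)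
  where
  open ℚ.≤-Reasoning
  K : ℚ
  K = fromℤ (+ suc k)
  instance
    K-positive : ℚ.Positive K
    K-positive = subst ℚ.Positive (sym (fromℤ≡integer (+ suc k))) _
  term : ∀ x a → ∣ a ∣ ℕ.≤ suc k → x ℚ.* fromℤ a ℚ.≤ ℚ.∣ x ∣ ℚ.* K
  term x a a≤ = begin
    x ℚ.* fromℤ a               ≤⟨ p≤∣p∣ (x ℚ.* fromℤ a) ⟩
    ℚ.∣ x ℚ.* fromℤ a ∣         ≡⟨ ℚ.∣p*q∣≡∣p∣*∣q∣ x (fromℤ a) ⟩
    ℚ.∣ x ∣ ℚ.* ℚ.∣ fromℤ a ∣   ≤⟨ ℚ.*-monoˡ-≤-nonNeg ℚ.∣ x ∣ {{ℚ.∣-∣-nonNeg x}} (∣fromℤ∣≤ {a} a≤) ⟩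
    ℚ.∣ x ∣ ℚ.* K               ∎
  double : fromℤ (+ 2) ℚ.* K ≡ fromℤ (+ (suc k ℕ.* 2))
  double = trans (cong (fromℤ (+ 2) ℚ.*_) (fromℤ≡integer (+ suc k)))
                 (cong fromℤ (ℤ.*-comm (+ 2) (+ suc k)))

-- The difference of two height functions

ℤ-induction : (P : ℤ → Set) → P 0ℤ → (∀ i → P i → P (i ℤ.+ 1ℤ)) → (∀ i → P (i ℤ.+ 1ℤ) → P i) → ∀ i → P i
ℤ-induction P base up down = λ { (+ n) → nonneg n ; -[1+ n ] → neg n }
  where
  nonneg : ∀ n → P (+ n)
  nonneg zero    = base
  nonneg (suc n) = subst P (cong +_ (ℕ.+-comm n 1)) (up (+ n) (nonneg n))
  neg : ∀ n → P -[1+ n ]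
  neg zero    = down -[1+ 0 ] base
  neg (suc n) = down -[1+ suc n ] (neg n)

-- Every unit edge is straddled by a domino.
edge-induction : (P : ℤ² → Set) → P 𝟎 → (∀ d → P (src d) → P (tgt d)) → (∀ d → P (tgt d) → P (src d)) → ∀ u → P u
edge-induction P base forward backward (i , j) =
  ℤ-induction (λ j → P (i , j))
    (ℤ-induction (λ i → P (i , 0ℤ)) base (λ i → proj₁ (east (i , 0ℤ))) (λ i → proj₂ (east (i , 0ℤ))) i)
    (λ j → subst P (cong (_, j ℤ.+ 1ℤ) (ℤ.+-identityʳ i)) ∘ proj₁ (north (i , j)))
    (λ j → proj₂ (north (i , j)) ∘ subst P (cong (_, j ℤ.+ 1ℤ) (sym (ℤ.+-identityʳ i)))) j
  where
  Linked : ℤ² → ℤ² → Set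
  Linked u w = (P u → P w) × (P w → P u)
  vertical-ends : ∀ p π → colour p ≡ π → Linked (p ⊕ e₂) (p ⊕ e₁₂)
  vertical-ends p 0ℙ eq = subst₂ Linked (vertical-src p eq) (vertical-tgt p eq)
    (forward (vertical p) , backward (vertical p))
  vertical-ends p 1ℙ eq = subst₂ Linked (vertical-tgt p eq) (vertical-src p eq)
    (backward (vertical p) , forward (vertical p))
  horizontal-ends : ∀ p π → colour p ≡ π → Linked (p ⊕ e₁) (p ⊕ e₁₂)
  horizontal-ends p 0ℙ eq = subst₂ Linked (horizontal-tgt p eq) (horizontal-src p eq)
    (backward (horizontal p) , forward (horizontal p))
  horizontal-ends p 1ℙ eq = subst₂ Linked (horizontal-src p eq) (horizontal-tgt p eq)
    (forward (horizontal p) , backward (horizontal p))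
  east : ∀ u → Linked u (u ⊕ e₁)
  east u = subst₂ Linked (⊕-cancel₂ u -e₂ e₂ refl) (⊕-assoc u -e₂ e₁₂) (vertical-ends (u ⊕ -e₂) _ refl)
  north : ∀ u → Linked u (u ⊕ e₂)
  north u = subst₂ Linked (⊕-cancel₂ u -e₁ e₁ refl) (⊕-assoc u -e₁ e₁₂) (horizontal-ends (u ⊕ -e₁) _ refl)

rise-difference : ∀ b c → ∃[ s ] rise b ≡ rise c ℤ.+ + 4 ℤ.* s
rise-difference false false = 0ℤ , refl
rise-difference false true  = 1ℤ , refl
rise-difference true  false = -1ℤ , refl
rise-difference true  true  = 0ℤ , refl

-- The increments +1 and -3 agree modulo 4, so congruence at the origin spreads along edges to every
-- vertex.
steep-congruent : ∀ {h h′} → Steep h → Steep h′ → h 𝟎 ≡ h′ 𝟎 → ∀ u → ∃[ e ] h u ≡ h′ u ℤ.+ + 4 ℤ.* e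
steep-congruent {h} {h′} steep steep′ eq₀ = edge-induction (λ u → ∃[ e ] h u ≡ h′ u ℤ.+ + 4 ℤ.* e)
  (0ℤ , trans eq₀ (sym (ℤ.+-identityʳ (h′ 𝟎))))
  (λ d (e , eq) → let b , p = steep d ; c , q = steep′ d ; s , r = rise-difference b c in
     e ℤ.+ s , forward {h (src d)} {h′ (src d)} {r′ = rise c} {s} {e} p q r eq)
  (λ d (e , eq) → let b , p = steep d ; c , q = steep′ d ; s , r = rise-difference b c in
     e ℤ.- s , backward {h (src d)} {h′ (src d)} {r′ = rise c} {s} {e} p q r eq)
  where
  forward : ∀ {x y x′ y′ r r′ s e} → x′ ≡ x ℤ.+ r → y′ ≡ y ℤ.+ r′ → r ≡ r′ ℤ.+ + 4 ℤ.* s → x ≡ y ℤ.+ + 4 ℤ.* e →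
            x′ ≡ y′ ℤ.+ + 4 ℤ.* (e ℤ.+ s)
  forward {y = y} {r′ = r′} {s} {e} refl refl refl refl = ring y r′ s e
    where
    ring : ∀ y r s e → y ℤ.+ + 4 ℤ.* e ℤ.+ (r ℤ.+ + 4 ℤ.* s) ≡ y ℤ.+ r ℤ.+ + 4 ℤ.* (e ℤ.+ s)
    ring = solve-∀
  backward : ∀ {x y x′ y′ r r′ s e} → x′ ≡ x ℤ.+ r → y′ ≡ y ℤ.+ r′ → r ≡ r′ ℤ.+ + 4 ℤ.* s → x′ ≡ y′ ℤ.+ + 4 ℤ.* e →
             x ≡ y ℤ.+ + 4 ℤ.* (e ℤ.- s)
  backward {x} {y} {r′ = r′} {s} {e} refl refl refl eq =
    ℤ+.∙-cancelʳ (r′ ℤ.+ + 4 ℤ.* s) x (y ℤ.+ + 4 ℤ.* (e ℤ.- s)) (trans eq (ring y r′ s e))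
    where
    ring : ∀ y r s e → y ℤ.+ r ℤ.+ + 4 ℤ.* e ≡ y ℤ.+ + 4 ℤ.* (e ℤ.- s) ℤ.+ (r ℤ.+ + 4 ℤ.* s)
    ring = solve-∀

-- The increment `r` is arbitrary so that both steepness and dips can be carried across the shift.
shift-steep : ∀ {g h : ℤ² → ℤ} c → (∀ u → g u ≡ h u ℤ.+ c) →
              ∀ d {r} → h (tgt d) ≡ h (src d) ℤ.+ r → g (tgt d) ≡ g (src d) ℤ.+ r
shift-steep {g} {h} c eq d {r} p = begin
  g (tgt d)                ≡⟨ eq (tgt d) ⟩
  h (tgt d) ℤ.+ c          ≡⟨ cong (ℤ._+ c) p ⟩
  h (src d) ℤ.+ r ℤ.+ c    ≡⟨ ring (h (src d)) r c ⟩
  h (src d) ℤ.+ c ℤ.+ r    ≡⟨ cong (ℤ._+ r) (eq (src d)) ⟨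
  g (src d) ℤ.+ r          ∎
  where
  open ≡-Reasoning
  ring : ∀ x r c → x ℤ.+ r ℤ.+ c ≡ x ℤ.+ c ℤ.+ r
  ring = solve-∀

∈⇒≤sum-map : ∀ {A : Set} (f : A → ℕ) {x xs} → x ∈ˡ xs → f x ℕ.≤ sum (map f xs)
∈⇒≤sum-map f {xs = x ∷ xs} (here refl)  = ℕ.m≤m+n (f x) (sum (map f xs))
∈⇒≤sum-map f {xs = y ∷ xs} (there x∈xs) = ℕ.≤-trans (∈⇒≤sum-map f x∈xs) (ℕ.m≤n+m (sum (map f xs)) (f y))

∣i∣≤n⇒+∣i+n∣≡i+n : ∀ i {n} → ∣ i ∣ ℕ.≤ n → + ∣ i ℤ.+ + n ∣ ≡ i ℤ.+ + n
∣i∣≤n⇒+∣i+n∣≡i+n (+ m)    _  = refl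
∣i∣≤n⇒+∣i+n∣≡i+n -[1+ m ] m<n rewrite ℤ.⊖-≥ m<n = refl

SlopedBy : Pred ℤ² 0ℓ → ℚ² → (ℤ² → ℤ) → Set
SlopedBy L φ h = ∀ v u → v ∈ L → fromℤ (+ 4) ℚ.* ⟪ φ , v ⟫ ≡ fromℤ (h (u ⊕ v) ℤ.- h u)

-- Both gains are four times the pairing of `φ` with `v`. Two different functions yield the
-- periodicity of their difference; one function taken twice yields its quasi-periodicity.
sameGain : ∀ {L φ h h′} → SlopedBy L φ h → SlopedBy L φ h′ →
           ∀ {v} → v ∈ L → ∀ u u′ → h (u ⊕ v) ℤ.+ h′ u′ ≡ h′ (u′ ⊕ v) ℤ.+ h u
sameGain {h = h} {h′} slope slope′ {v} v∈L u u′ =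
  rearrange (h (u ⊕ v)) (h u) (h′ (u′ ⊕ v)) (h′ u′) (fromℤ-injective (trans (sym (slope v u v∈L)) (slope′ v u′ v∈L)))
  where
  ring₁ : ∀ a b d → a ℤ.+ d ≡ a ℤ.- b ℤ.+ (b ℤ.+ d)
  ring₁ = solve-∀
  ring₂ : ∀ b c d → c ℤ.- d ℤ.+ (b ℤ.+ d) ≡ c ℤ.+ b
  ring₂ = solve-∀
  rearrange : ∀ a b c d → a ℤ.- b ≡ c ℤ.- d → a ℤ.+ d ≡ c ℤ.+ b
  rearrange a b c d eq = trans (ring₁ a b d) (trans (cong (ℤ._+ (b ℤ.+ d)) eq) (ring₂ b c d))

sloped⇒gentle : ∀ {L φ h} → φ ∈ int Q → SlopedBy L φ h → Gentle L h
sloped⇒gentle {φ = φ@(x , y)} {h} φ∈intQ slope k {a} {b} ab∈L a≤ b≤ u eq =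
  flux-bound {x} {y} {a} {b} {k} (intQ⇒<½ φ∈intQ) a≤ b≤
    (trans (slope (a , b) u ab∈L) (cong fromℤ (trans (cong (ℤ._- h u) eq) (ring (h u) (+ (suc k ℕ.* 2))))))
  where
  ring : ∀ x y → x ℤ.+ y ℤ.- x ≡ y
  ring = solve-∀

module _ {L} (lattice : EvenCocompact L) {φ h h′}
         (steep : Steep h) (steep′ : Steep h′) (eq₀ : h 𝟎 ≡ h′ 𝟎)
         (slope : SlopedBy L φ h) (slope′ : SlopedBy L φ h′) where
  open EvenCocompact lattice

  private
    E : ℤ² → ℤ
    E u = proj₁ (steep-congruent {h} {h′} steep steep′ eq₀ u)

    h≡ : ∀ u → h u ≡ h′ u ℤ.+ + 4 ℤ.* E u
    h≡ u = proj₂ (steep-congruent {h} {h′} steep steep′ eq₀ u)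

    E-periodic : ∀ {v} → v ∈ L → ∀ u → E (u ⊕ v) ≡ E u
    E-periodic {v} v∈L u = lemma {a = h′ (u ⊕ v)} {h′ u} (h≡ (u ⊕ v)) (h≡ u) (sameGain {L} {φ} {h} {h′} slope slope′ v∈L u u)
      where
      ring₁ : ∀ a b e → a ℤ.+ b ℤ.+ + 4 ℤ.* e ≡ a ℤ.+ + 4 ℤ.* e ℤ.+ b
      ring₁ = solve-∀
      ring₂ : ∀ a b e → a ℤ.+ (b ℤ.+ + 4 ℤ.* e) ≡ a ℤ.+ b ℤ.+ + 4 ℤ.* e
      ring₂ = solve-∀
      lemma : ∀ {x y a b e e′} → x ≡ a ℤ.+ + 4 ℤ.* e → y ≡ b ℤ.+ + 4 ℤ.* e′ → x ℤ.+ b ≡ a ℤ.+ y → e ≡ e′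
      lemma {a = a} {b} {e} {e′} refl refl eq = ℤ.*-cancelˡ-≡ (+ 4) e e′
        (ℤ+.∙-cancelˡ (a ℤ.+ b) (+ 4 ℤ.* e) (+ 4 ℤ.* e′) (trans (ring₁ a b e) (trans eq (ring₂ a b e′))))

    -- A sum over representatives bounds `∣ E ∣` everywhere by periodicity, and is simpler than a
    -- maximum.
    M : ℕ
    M = sum (map (λ r → ∣ E r ∣) reps)

    ∣E∣≤M : ∀ u → ∣ E u ∣ ℕ.≤ M
    ∣E∣≤M u = let r , v , r∈ , v∈L , eq = reduce u in
      subst (λ e → ∣ e ∣ ℕ.≤ M) (sym (trans (cong E eq) (E-periodic v∈L r))) (∈⇒≤sum-map (λ r → ∣ E r ∣) r∈)

    -- The absolute value only converts to ℕ, as `E u + M` is nonnegative; adding `M` shifts the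
    -- upper function by `4 M`.
    D : ℤ² → ℕ
    D u = ∣ E u ℤ.+ + M ∣

    lift≡ : ∀ u → lift h′ D u ≡ h u ℤ.+ + 4 ℤ.* + M
    lift≡ u = begin
      h′ u ℤ.+ + 4 ℤ.* + ∣ E u ℤ.+ + M ∣      ≡⟨ cong (λ i → h′ u ℤ.+ + 4 ℤ.* i) (∣i∣≤n⇒+∣i+n∣≡i+n (E u) (∣E∣≤M u)) ⟩
      h′ u ℤ.+ + 4 ℤ.* (E u ℤ.+ + M)          ≡⟨ ring (h′ u) (E u) (+ M) ⟩
      h′ u ℤ.+ + 4 ℤ.* E u ℤ.+ + 4 ℤ.* + M    ≡⟨ cong (ℤ._+ + 4 ℤ.* + M) (h≡ u) ⟨
      h u ℤ.+ + 4 ℤ.* + M                     ∎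
      where
      open ≡-Reasoning
      ring : ∀ x y z → x ℤ.+ + 4 ℤ.* (y ℤ.+ z) ≡ x ℤ.+ + 4 ℤ.* y ℤ.+ + 4 ℤ.* z
      ring = solve-∀

    h≡lift : ∀ u → h u ≡ lift h′ D u ℤ.+ ℤ.- (+ 4 ℤ.* + M)
    h≡lift u = sym (trans (cong (ℤ._- (+ 4 ℤ.* + M)) (lift≡ u)) (ℤ+.//-rightDividesʳ (+ 4 ℤ.* + M) (h u)))

  connected : φ ∈ int Q → ∀ {t t′} → dominoes t ≐ Dips h → dominoes t′ ≐ Dips h′ → t ≈ t′ ⊎ Star (Flip L) t t′
  connected φ∈intQ {t} {t′} (t⊆ , ⊆t) t′≐ =
    -- `h′` is the floor of the descent, which starts at `h` raised by `4 M`.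
    descend lattice {h′} steep′ (sameGain {L} {φ} {h′} {h′} slope′ slope′) (sloped⇒gentle {L} {φ} {h′} φ∈intQ slope′)
      (suc (weight lattice D)) {t} {t′} (record
        { excess    = D
        ; invariant = λ v∈L u → cong (λ e → ∣ e ℤ.+ + M ∣) (E-periodic v∈L u)
        ; steep     = λ d → map₂ (shift-steep {lift h′ D} {h} (+ 4 ℤ.* + M) lift≡ d) (steep d)
        ; tiles     = (λ {d} x → shift-steep {lift h′ D} {h} (+ 4 ℤ.* + M) lift≡ d (t⊆ {d} x))
                    , (λ {d} x → ⊆t {d} (shift-steep {h} {lift h′ D} (ℤ.- (+ 4 ℤ.* + M)) h≡lift d x))
        ; bound     = ℕ.n<1+n (weight lattice D)
        }) t′≐

corollary6p2p6 : (L : Pred ℤ² 0ℓ) → ValidLattice L →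
    ∀ φ → φ ∈ 𝓕 L ∩ int Q →
    (t t′ : TorusTiling L) → HasFlux t φ → HasFlux t′ φ → ¬ (t ≈ t′) →
    Star (Flip L) t t′
corollary6p2p6 L valid φ (_ , φ∈intQ) t t′ (h , height , slope) (h′ , height′ , slope′) t≉t′ =
  [ (λ t≈t′ → contradiction t≈t′ t≉t′) , id ]′
    (connected (evenCocompact valid) {φ} {h} {h′}
      (height-steep (isTiling t) height) (height-steep (isTiling t′) height′)
      (trans (IsHeightFunction.origin height) (sym (IsHeightFunction.origin height′))) slope slope′ φ∈intQ {t} {t′}
      (height-dips (isTiling t) height) (height-dips (isTiling t′) height′))
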